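{- For every integer $n\geq 1$, the algorithm $\mathrm{EnumBPeq0}$ (described in the context) on input $n$ enumerates $\mathsf{BP}_n^0$: identifying each output with the partitioned order it represents, all outputs belong to $\mathsf{BP}_n$, and for every equivalence class of $\equiv_0$ on $\mathsf{BP}_n$ exactly one output (counted with multiplicity) belongs to that class.
   Context: Notation: $\llbracket n\rrbracket=\{0,\dots,n-1\}$. A partitioned order of $\llbracket n\rrbracket$ is an (unordered) set $\{S_k\}_{k\in\llbracket s\rrbracket}$ of $s$ sequences $S_k=(i^k_0,\dots,i^k_{n_k-1})$ with $n_k>0$, each consisting of pairwise distinct elements of $\llbracket n\rrbracket$, the sequences being pairwise disjoint (as sets of entries) with union $\llbracket n\rrbracket$. The sequences are called o-blocks. $\mathsf{BP}_n$ is the set of all partitioned orders of $\llbracket n\rrbracket$ (block-parallel update modes of size $n$). For $\mu=\{S_k\}_{k\in\llbracket s\rrbracket}\in\mathsf{BP}_n$, let $p=\mathrm{lcm}(n_0,\dots,n_{s-1})$ and define the sequence of blocks $\varphi(\mu)=(W_\ell)_{\ell\in\llbracket p\rrbracket}$ by $W_\ell=\{i^k_{\ell \bmod n_k}\mid k\in\llbracket s\rrbracket\}$. For $\mu,\mu'\in\mathsf{BP}_n$, $\mu\equiv_0\mu'$ means $\varphi(\mu)=\varphi(\mu')$; $\mathsf{BP}_n^0=\mathsf{BP}_n/\equiv_0$. Integer partitions: $p(n)$ is the number of integer partitions of $n$, listed in some fixed order as partitions number $1,\dots,p(n)$; $d(i)$ is the maximal part size of the $i$-th partition, and $m(i,j)$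 is the multiplicity of the part of size $j$ in it (possibly $0$). Matrix representation: a list $M=(M_1,\dots,M_{d(i)})$, where $M_j$ is a matrix with $m(i,j)$ rows and $j$ columns (empty if $m(i,j)=0$) such that each element of $\llbracket n\rrbracket$ is an entry exactly once overall, represents the partitioned order whose o-blocks are all the rows of all the matrices (each row read from left to right). Algorithm $\mathrm{EnumBPeq0}(n)$: for each partition $i$ of $n$, call $\mathrm{Aux}(n,i,1)$. $\mathrm{Aux}(n,i,j,M_1,\dots,M_{j-1})$: (1) If $d(i)<j$, output $M=(M_1,\dots,M_{j-1})$ and return. (2) Otherwise, if $m(i,j)>0$: for each subset $A$ of size $j\cdot m(i,j)$ of the elements of $\llbracket n\rrbracket$ not occurring in $M_1,\dots,M_{j-1}$, and for each matrix $M_j$ enumerated by $\mathrm{Block}(A,j,m(i,j))$, call $\mathrm{Aux}(n,i,j+1,M_1,\dots,M_{j-1},M_j)$. (3) Otherwise ($m(i,j)=0$), call $\mathrm{Aux}(n,i,j+1,M_1,\dots,M_{j-1},\emptyset)$. $\mathrm{Block}(A,j,m)$: for each list of columns $C=(C_1,\dots,C_j)$ enumerated by $\mathrm{BlockAux}(A,m)$, enumerate the matrix $M_j$ with $M_j[k][\ell]=C_\ell[k]$ for $1\le k\le m$, $1\le\ell\le j$, where the elements of each set $C_\ell$ are listed in some fixed order (e.g. increasing) as $C_\ell[1],\dots,C_\ell[m]$. $\mathrm{BlockAux}(A,m,C_1,\dots,C_\ell)$: if $A=\emptyset$, enumerate $(C_1,\dots,C_\ell)$ and return; otherwise, for each subset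 $B\subseteq A$ of size $m$, call $\mathrm{BlockAux}(A\setminus B,m,C_1,\dots,C_\ell,B)$. -}

module Defs where

open import Data.Bool using (if_then_else_; true; false)
import Data.Bool.Properties as Bool
open import Data.Fin as Fin using (Fin)
open import Data.Fin.Subset as Subset
  using (Subset; inside; outside; ⁅_⁆; ⋃; ∁; ∣_∣; _⊆_; _─_)
open import Data.Fin.Subset.Properties
  using (nonempty?; _⊆?_; _∈?_; ∣⊥∣≡0; Empty-unique; p∩q≢∅⇒∣p─q∣<∣p∣; x∈p∩q⁺)
open import Data.List
  using (List; []; _∷_; [_]; _++_; _∷ʳ_; map; concat; concatMap; filter; foldr; length; lookup;
         replicate; upTo; zipWith; allFin; cartesianProductWith; deduplicate)
import Data.List.Properties as List
open import Data.List.Membership.Propositional using (_∈_)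
open import Data.List.Membership.Propositional.Properties
  using (∈-filter⁺; ∈-filter⁻; ∈-allFin; ∈-upTo⁺; ∈-cartesianProductWith⁺; ∈-deduplicate⁺; ∈-deduplicate⁻)
open import Data.List.Relation.Binary.Disjoint.Propositional using (Disjoint)
open import Data.List.Relation.Unary.All as All using (All; []; _∷_)
open import Data.List.Relation.Unary.AllPairs using (AllPairs)
open import Data.List.Relation.Unary.Any using (Any; here; there)
open import Data.List.Relation.Unary.Linked using (Linked; linked?)
open import Data.List.Relation.Unary.Unique.Propositional using (Unique)
open import Data.List.Relation.Unary.Unique.DecPropositional.Properties using (deduplicate-!)
open import Data.Nat
  using (ℕ; zero; suc; _+_; _*_; _∸_; _≤_; _<_; _≥_; _⊔_; _≟_; _<?_; _≥?_; NonZero; s≤s; ≢-nonZero⁻¹)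
open import Data.Nat.DivMod using (_mod_)
open import Data.Nat.LCM using (lcm)
open import Data.Nat.ListAction using (sum)
open import Data.Nat.Properties
  using (≤-refl; ≤-trans; ≤-reflexive; <-≤-trans; m≤m+n; m≤n+m)
open import Data.Product using (Σ; ∃; _×_; _,_; proj₁; proj₂)
open import Data.Vec using ([]; _∷_)
import Data.Vec.Properties as Vec
open import Function using (_⇔_; mk⇔; _∘_; Equivalence)
open import Relation.Binary.Definitions using (DecidableEquality)
open import Relation.Binary.PropositionalEquality using (_≡_; refl; sym; trans; cong; cong₂)
open import Relation.Nullary using (does; yes; no; contradiction)
open import Relation.Nullary.Decidable using (_×-dec_; map′)
open import Relation.Unary using (Decidable)

-- Since o-blocks are nonempty and pairwise disjoint, a list satisfying this
-- predicate has no repeated o-block; two lists present the same partitioned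
-- order iff they are permutations of each other.  φ below does not depend on
-- the order of the o-blocks, so quantifying over lists is the same as
-- quantifying over partitioned orders as far as _≡₀_ is concerned.
record IsPartitionedOrder {n : ℕ} (Ss : List (List (Fin n))) : Set where
  field
    nonempty : All (λ S → NonZero (length S)) Ss
    distinct : All Unique Ss
    disjoint : AllPairs Disjoint Ss
    covering : ∀ i → Any (i ∈_) Ss

BP : ℕ → Set
BP n = Σ (List (List (Fin n))) IsPartitionedOrder

module _ {n : ℕ} where

  period : BP n → ℕ
  period (Ss , _) = foldr lcm 1 (map length Ss)

  W : BP n → ℕ → Subset n
  W (_ , po) ℓ =
    ⋃ (All.reduce (λ {S} n≢0 → ⁅ lookup S (_mod_ ℓ (length S) {{n≢0}}) ⁆)
                  (IsPartitionedOrder.nonempty po))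

  φ : BP n → List (Subset n)
  φ μ = map (W μ) (upTo (period μ))

  infix 4 _≡₀_
  _≡₀_ : BP n → BP n → Set
  μ ≡₀ μ′ = φ μ ≡ φ μ′

record IsPartition (n : ℕ) (ps : List ℕ) : Set where
  constructor isPartition
  field
    decreasing : Linked _≥_ ps
    positive   : All (0 <_) ps
    total      : sum ps ≡ n

maxPart : List ℕ → ℕ
maxPart = foldr _⊔_ 0

multiplicity : List ℕ → ℕ → ℕ
multiplicity ps j = length (filter (j ≟_) ps)

infix 4 _Enumerates_
_Enumerates_ : ∀ {A : Set} → List A → (A → Set) → Set
xs Enumerates P = Unique xs × (∀ x → x ∈ xs ⇔ P x)

-- What the algorithm leaves open: the order in which partitions and subsets
-- are run through, and the order in which the elements of a set are listed.
record Orders (n : ℕ) : Set where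
  field
    partitions         : List (List ℕ)
    partitions-correct : partitions Enumerates IsPartition n
    subsets            : Subset n → ℕ → List (Subset n)
    subsets-correct    : ∀ A m → subsets A m Enumerates (λ B → B ⊆ A × ∣ B ∣ ≡ m)
    elements           : Subset n → List (Fin n)
    elements-correct   : ∀ C → elements C Enumerates (Subset._∈ C)

private
  enumerate : ∀ {A : Set} {P : A → Set} → DecidableEquality A → Decidable P →
              (xs : List A) → (∀ {x} → P x → x ∈ xs) → ∃ (_Enumerates P)
  enumerate _≡?_ P? xs complete =
    deduplicate _≡?_ (filter P? xs) ,
    deduplicate-! _≡?_ (filter P? xs) ,
    λ x → mk⇔ (proj₂ ∘ ∈-filter⁻ P? {xs = xs} ∘ ∈-deduplicate⁻ _≡?_ (filter P? xs))
              (λ px → ∈-deduplicate⁺ _≡?_ (∈-filter⁺ P? (complete px) px))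

  allSubsets : ∀ n → List (Subset n)
  allSubsets zero    = [ [] ]
  allSubsets (suc n) = cartesianProductWith _∷_ (inside ∷ outside ∷ []) (allSubsets n)

  ∈-allSubsets : ∀ {n} (B : Subset n) → B ∈ allSubsets n
  ∈-allSubsets []          = here refl
  ∈-allSubsets (true  ∷ B) = ∈-cartesianProductWith⁺ _∷_ {xs = inside ∷ outside ∷ []} (here refl) (∈-allSubsets B)
  ∈-allSubsets (false ∷ B) = ∈-cartesianProductWith⁺ _∷_ {xs = inside ∷ outside ∷ []} (there (here refl)) (∈-allSubsets B)

  words : ℕ → ℕ → List (List ℕ)
  words b zero    = [ [] ]
  words b (suc k) = [] ∷ cartesianProductWith _∷_ (upTo b) (words b k)

  ∈-words : ∀ b k {ps} → All (0 <_) ps → sum ps < b → sum ps ≤ k → ps ∈ words b k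
  ∈-words b zero    []         _ _ = here refl
  ∈-words b zero    (s≤s _ ∷ _) _ ()
  ∈-words b (suc k) []         _ _ = here refl
  ∈-words b (suc k) {suc p ∷ ps} (s≤s _ ∷ pos) Σ<b (s≤s Σ≤k) =
    there (∈-cartesianProductWith⁺ _∷_
      (∈-upTo⁺ (≤-trans (s≤s (m≤m+n (suc p) (sum ps))) Σ<b))
      (∈-words b k pos (≤-trans (s≤s (m≤n+m (sum ps) (suc p))) Σ<b)
                       (≤-trans (m≤n+m (sum ps) p) Σ≤k)))

  isPartition? : ∀ n → Decidable (IsPartition n)
  isPartition? n ps =
    map′ (λ (d , p , t) → isPartition d p t) (λ (isPartition d p t) → d , p , t)
         (linked? _≥?_ ps ×-dec All.all? (0 <?_) ps ×-dec (sum ps ≟ n))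

someOrders : ∀ n → Orders n
someOrders n = record
  { partitions         = proj₁ parts
  ; partitions-correct = proj₂ parts
  ; subsets            = λ A m → proj₁ (subs A m)
  ; subsets-correct    = λ A m → proj₂ (subs A m)
  ; elements           = proj₁ ∘ elems
  ; elements-correct   = proj₂ ∘ elems
  }
  where
  parts = enumerate (List.≡-dec _≟_) (isPartition? n) (words (suc n) n)
            (λ (isPartition _ p t) →
              ∈-words (suc n) n p (s≤s (≤-reflexive t)) (≤-reflexive t))
  subs = λ (A : Subset n) m →
    enumerate {P = λ B → B ⊆ A × ∣ B ∣ ≡ m} (Vec.≡-dec Bool._≟_)
              (λ B → (B ⊆? A) ×-dec (∣ B ∣ ≟ m)) (allSubsets n) (λ {B} _ → ∈-allSubsets B)
  elems = λ (C : Subset n) →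
    enumerate {P = Subset._∈ C} Fin._≟_ (_∈? C) (allFin n) (λ {i} _ → ∈-allFin i)

-- A matrix is the list of its rows.
Matrix : Set → Set
Matrix A = List (List A)

-- The matrix with m rows having the given columns, each of length m.
fromColumns : ∀ {A : Set} → ℕ → List (List A) → Matrix A
fromColumns m = foldr (zipWith _∷_) (replicate m [])

-- The o-blocks are the rows of all the matrices.
represented : ∀ {A : Set} → List (Matrix A) → List (List A)
represented = concat

module Algorithm {n : ℕ} (orders : Orders n) where
  open Orders orders

  -- The first argument bounds the recursion depth.  Each call removes m
  -- elements from A, so for m > 0 the bound in blockAux is never reached;
  -- see blockAux-unfold.
  blockAux′ : ℕ → Subset n → ℕ → List (Subset n) → List (List (Subset n))
  blockAux′ zero    A m Cs = []
  blockAux′ (suc k) A m Cs =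
    if does (nonempty? A)
    then concatMap (λ B → blockAux′ k (A ─ B) m (Cs ∷ʳ B)) (subsets A m)
    else [ Cs ]

  blockAux : Subset n → ℕ → List (Subset n) → List (List (Subset n))
  blockAux A = blockAux′ (suc ∣ A ∣) A

  private
    concatMap-cong-∈ : ∀ {X Y : Set} {f g : X → List Y} (xs : List X) →
                       (∀ {x} → x ∈ xs → f x ≡ g x) → concatMap f xs ≡ concatMap g xs
    concatMap-cong-∈ []       eq = refl
    concatMap-cong-∈ (x ∷ xs) eq =
      cong₂ _++_ (eq (here refl)) (concatMap-cong-∈ xs (eq ∘ there))

    shrinks : ∀ A m .{{_ : NonZero m}} {B} → B ∈ subsets A m → ∣ A ─ B ∣ < ∣ A ∣
    shrinks A m {B} B∈ with nonempty? B | Equivalence.to (proj₂ (subsets-correct A m) B) B∈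
    ... | yes (i , i∈B) | B⊆A , _   =
      p∩q≢∅⇒∣p─q∣<∣p∣ A B (i , x∈p∩q⁺ (B⊆A i∈B , i∈B))
    ... | no  B≡∅       | _   , ∣B∣ =
      contradiction (trans (sym ∣B∣) (trans (cong ∣_∣ (Empty-unique B≡∅)) (∣⊥∣≡0 n)))
                    (≢-nonZero⁻¹ m)

    bound-irrelevant : ∀ k k′ A m .{{_ : NonZero m}} Cs → ∣ A ∣ < k → ∣ A ∣ < k′ →
                       blockAux′ k A m Cs ≡ blockAux′ k′ A m Cs
    bound-irrelevant (suc k) (suc k′) A m Cs (s≤s A≤k) (s≤s A≤k′) with does (nonempty? A)
    ... | false = refl
    ... | true  = concatMap-cong-∈ (subsets A m) λ {B} B∈ →
      bound-irrelevant k k′ (A ─ B) m (Cs ∷ʳ B)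
        (<-≤-trans (shrinks A m B∈) A≤k) (<-≤-trans (shrinks A m B∈) A≤k′)

  blockAux-unfold : ∀ A m .{{_ : NonZero m}} Cs →
    blockAux A m Cs ≡
      (if does (nonempty? A)
       then concatMap (λ B → blockAux (A ─ B) m (Cs ∷ʳ B)) (subsets A m)
       else [ Cs ])
  blockAux-unfold A m Cs with does (nonempty? A)
  ... | false = refl
  ... | true  = concatMap-cong-∈ (subsets A m) λ {B} B∈ →
    bound-irrelevant ∣ A ∣ (suc ∣ A ─ B ∣) (A ─ B) m (Cs ∷ʳ B) (shrinks A m B∈) ≤-refl

  -- The number of columns, ∣ A ∣ / m, need not be given.
  block : Subset n → ℕ → List (Matrix (Fin n))
  block A m = map (fromColumns m ∘ map elements) (blockAux A m [])

  unused : List (Matrix (Fin n)) → Subset n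
  unused Ms = ∁ (⋃ (map ⁅_⁆ (concat (concat Ms))))

  -- The first argument is the number of values of j still to be treated, so
  -- that the stopping condition maxPart ps < j amounts to its being zero.
  aux′ : ℕ → List ℕ → ℕ → List (Matrix (Fin n)) → List (List (Matrix (Fin n)))
  aux′ zero    ps j Ms = [ Ms ]
  aux′ (suc k) ps j Ms with multiplicity ps j
  ... | zero      = aux′ k ps (suc j) (Ms ∷ʳ [])
  ... | m@(suc _) =
    concatMap (λ A → concatMap (λ Mⱼ → aux′ k ps (suc j) (Ms ∷ʳ Mⱼ)) (block A m))
              (subsets (unused Ms) (j * m))

  aux : List ℕ → ℕ → List (Matrix (Fin n)) → List (List (Matrix (Fin n)))
  aux ps j = aux′ (suc (maxPart ps) ∸ j) ps j

  enumBPeq0 : List (List (Matrix (Fin n)))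
  enumBPeq0 = concatMap (λ ps → aux ps 1 []) partitions

{-# OPTIONS --safe #-}
module Submission where

-- In W ℓ, the element at position r of an o-block of length j occurs exactly when ℓ ≡ r (mod j),
-- and a residue class determines its modulus and its residue.  Hence μ ≡₀ μ′ iff every element has
-- the same block length j and the same position r in μ and μ′, that is, iff the sets C(j , r) of the
-- elements at position r of the o-blocks of length j agree.  The algorithm chooses exactly these
-- sets, each family once: the multiplicities of the partition are the sizes of the C(j , r), the
-- subset chosen at stage j is the union of the C(j , r), and the columns of the j-th matrix are the
-- C(j , r) themselves, in order; only the matching of the columns into rows is left to the fixed order.

open import Defs
open import Data.Bool using (true; false; if_then_else_)
open import Data.Empty using (⊥)
open import Data.Fin using (Fin; zero; suc; toℕ)
open import Data.Fin.Properties using (toℕ-fromℕ<)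
open import Data.Fin.Subset as Subset using (Subset; ⁅_⁆; ⋃; ∣_∣; _∪_; _─_; Empty; Nonempty)
open import Data.Fin.Subset.Properties
open import Data.List
  using (List; []; _∷_; _++_; _∷ʳ_; [_]; map; filter; concat; concatMap; foldr; length; lookup;
         replicate; upTo; zipWith)
open import Data.List.Membership.Propositional using (_∈_; _∉_; find; lose)
open import Data.List.Membership.Propositional.Properties
open import Data.List.Properties hiding (≡-dec)
open import Data.List.Relation.Binary.Disjoint.Propositional using (Disjoint)
open import Data.List.Relation.Binary.Permutation.Propositional
  using (_↭_; ↭-refl; ↭-reflexive; ↭-sym; ↭-trans; ↭-prep; ↭⇒↭ₛ; module PermutationReasoning)
open import Data.List.Relation.Binary.Permutation.Propositional.Properties
  using (↭-length; filter-↭; ++⁺ˡ; ++⁺ʳ; shift; shifts; All-resp-↭; ∈-resp-↭)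
import Data.List.Relation.Binary.Permutation.Setoid.Properties as Permutation
open import Data.List.Relation.Unary.All as All using (All; []; _∷_)
import Data.List.Relation.Unary.All.Properties as All
open import Data.List.Relation.Unary.AllPairs using (AllPairs; []; _∷_)
import Data.List.Relation.Unary.AllPairs.Properties as AllPairs
open import Data.List.Relation.Unary.Any as Any using (Any; here; there)
import Data.List.Relation.Unary.Any.Properties as Any
open import Data.List.Relation.Unary.Linked.Properties using (Linked⇒AllPairs)
open import Data.List.Relation.Unary.Unique.Propositional using (Unique)
import Data.List.Relation.Unary.Unique.Propositional.Properties as Unique
import Data.List.Sort
open import Data.Nat
open import Data.Nat.Divisibility
  using (_∣_; divides; ∣-antisym; ∣-trans; ∣m+n∣m⇒∣n; 1∣_; m∣m*n; n∣m*n; 0∣⇒≡0)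
open import Data.Nat.DivMod
  using (_mod_; m≡m%n+[m/n]*n; [m+kn]%n≡m%n; [m+n]%n≡m%n; m∣n⇒o%n%m≡o%m; m<n⇒m%n≡m; m%n<n)
open import Data.Nat.LCM using (lcm; m∣lcm[m,n]; n∣lcm[m,n]; lcm-least)
open import Data.Nat.ListAction using (sum)
open import Data.Nat.ListAction.Properties using (sum-↭)
open import Data.Nat.Properties hiding (_≟_)
open import Data.Product using (Σ-syntax; ∃; ∃₂; ∃!; _×_; _,_; proj₁; proj₂)
open import Data.Sum using (_⊎_; inj₁; inj₂)
open import Data.Vec as Vec using ([]; _∷_)
open import Function using (_⇔_; mk⇔; id; _∘_; _on_; Equivalence)
open import Relation.Binary.Construct.Flip.EqAndOrd using (decTotalOrder)
open import Relation.Binary.Definitions using (Tri; tri<; tri≈; tri>)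
open import Relation.Binary.PropositionalEquality
  using (_≡_; _≢_; refl; sym; trans; cong; cong₂; subst; subst₂; setoid; module ≡-Reasoning)
open import Relation.Nullary using (¬_; contradiction; Dec; does; yes; no)
open import Relation.Unary using (Decidable)

open Equivalence using (to; from)

-- `φ` shows only finitely many blocks, but `period` is a multiple of every o-block length, so
-- `φ μ ≡ φ ν` decides membership at every time ℓ, and whole residue classes can be compared. In the
-- converse direction the locations must also determine the period; they do because o-blocks are
-- nonempty, so that each length shows up in the location of some element.
--
-- Uniqueness is counted with multiplicity, so it is proved as pairwise inequivalence along the
-- output list: in each nested loop, different choices must lead to inequivalent outputs. The choice
-- made at stage j can be read back because earlier stages leave shorter rows and later ones longer
-- rows. Reading back the columns of a matrix requires their number, which comes from counting
-- entries; reading back the partition uses that each row of length j holds j entries. All this is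
-- done with `_≈_`, which unlike `_≡₀_` also applies to partial outputs; `_≡₀_` returns only in the
-- last step.

private variable
  A B : Set
  n : ℕ

-- Lists, positions in lists, and finite sets given by lists

++⁻ : ∀ {R : A → A → Set} xs {ys} → AllPairs R (xs ++ ys) →
      AllPairs R xs × AllPairs R ys × All (λ x → All (R x) ys) xs
++⁻ []       ys! = [] , ys! , []
++⁻ (x ∷ xs) (x# ∷ xys!) with ++⁻ xs xys!
... | xs! , ys! , # = All.++⁻ˡ xs x# ∷ xs! , ys! , All.++⁻ʳ xs x# ∷ #

unique-++⁻ : ∀ (xs : List A) {ys} → Unique (xs ++ ys) → Unique xs × Unique ys × Disjoint xs ys
unique-++⁻ xs xys! with ++⁻ xs xys!
... | xs! , ys! , # = xs! , ys! , λ (x∈xs , x∈ys) → All.lookup (All.lookup # x∈xs) x∈ys refl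

-- Positions are plain naturals, and a position beyond the end gives `⊥`; so positions in lists of
-- different lengths compare without casts between `Fin` types.
AnyAt : (A → Set) → ℕ → List A → Set
AnyAt P ℓ       []       = ⊥
AnyAt P zero    (x ∷ xs) = P x
AnyAt P (suc ℓ) (x ∷ xs) = AnyAt P ℓ xs

module _ {P : A → Set} where

  anyAt⇒any : ∀ ℓ xs → AnyAt P ℓ xs → Any P xs
  anyAt⇒any zero    (x ∷ xs) p = here p
  anyAt⇒any (suc ℓ) (x ∷ xs) p = there (anyAt⇒any ℓ xs p)

  any⇒anyAt : ∀ {xs} → Any P xs → ∃ λ ℓ → AnyAt P ℓ xs
  any⇒anyAt (here p)  = zero , p
  any⇒anyAt (there p) = let ℓ , q = any⇒anyAt p in suc ℓ , q

  anyAt-< : ∀ ℓ xs → AnyAt P ℓ xs → ℓ < length xs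
  anyAt-< zero    (x ∷ xs) p = s≤s z≤n
  anyAt-< (suc ℓ) (x ∷ xs) p = s≤s (anyAt-< ℓ xs p)

  anyAt-lookup⁺ : ∀ xs k → P (lookup xs k) → AnyAt P (toℕ k) xs
  anyAt-lookup⁺ (x ∷ xs) zero    p = p
  anyAt-lookup⁺ (x ∷ xs) (suc k) p = anyAt-lookup⁺ xs k p

  anyAt-lookup⁻ : ∀ xs k → AnyAt P (toℕ k) xs → P (lookup xs k)
  anyAt-lookup⁻ (x ∷ xs) zero    p = p
  anyAt-lookup⁻ (x ∷ xs) (suc k) p = anyAt-lookup⁻ xs k p

anyAt-functional : ∀ {x : A} {xs} → Unique xs → ∀ ℓ ℓ′ →
                   AnyAt (x ≡_) ℓ xs → AnyAt (x ≡_) ℓ′ xs → ℓ ≡ ℓ′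
anyAt-functional (x# ∷ xs!) zero    zero     p    q    = refl
anyAt-functional (x# ∷ xs!) zero    (suc ℓ′) refl q    =
  contradiction refl (All.lookup x# (anyAt⇒any ℓ′ _ q))
anyAt-functional (x# ∷ xs!) (suc ℓ) zero     p    refl =
  contradiction refl (All.lookup x# (anyAt⇒any ℓ _ p))
anyAt-functional (x# ∷ xs!) (suc ℓ) (suc ℓ′) p    q    = cong suc (anyAt-functional xs! ℓ ℓ′ p q)

toSet : List (Fin n) → Subset n
toSet = ⋃ ∘ map ⁅_⁆

∈-toSet⁺ : ∀ {i : Fin n} {xs} → i ∈ xs → i Subset.∈ toSet xs
∈-toSet⁺ (here refl)  = x∈p∪q⁺ (inj₁ (x∈⁅x⁆ _))
∈-toSet⁺ (there i∈xs) = x∈p∪q⁺ (inj₂ (∈-toSet⁺ i∈xs))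

∈-toSet⁻ : ∀ {i : Fin n} xs → i Subset.∈ toSet xs → i ∈ xs
∈-toSet⁻ []       i∈ = contradiction i∈ ∉⊥
∈-toSet⁻ (x ∷ xs) i∈ with x∈p∪q⁻ ⁅ x ⁆ (toSet xs) i∈
... | inj₁ i∈⁅x⁆ = here (x∈⁅y⁆⇒x≡y x i∈⁅x⁆)
... | inj₂ i∈xs  = there (∈-toSet⁻ xs i∈xs)

∣⁅x⁆∪p∣≡1+∣p∣ : ∀ x (p : Subset n) → x Subset.∉ p → ∣ ⁅ x ⁆ ∪ p ∣ ≡ suc ∣ p ∣
∣⁅x⁆∪p∣≡1+∣p∣ zero    (true  ∷ p) x∉p = contradiction Vec.here x∉p
∣⁅x⁆∪p∣≡1+∣p∣ zero    (false ∷ p) x∉p = cong (suc ∘ ∣_∣) (∪-identityˡ p)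
∣⁅x⁆∪p∣≡1+∣p∣ (suc x) (true  ∷ p) x∉p = cong suc (∣⁅x⁆∪p∣≡1+∣p∣ x p (x∉p ∘ Vec.there))
∣⁅x⁆∪p∣≡1+∣p∣ (suc x) (false ∷ p) x∉p = ∣⁅x⁆∪p∣≡1+∣p∣ x p (x∉p ∘ Vec.there)

∣toSet∣ : ∀ {xs : List (Fin n)} → Unique xs → ∣ toSet xs ∣ ≡ length xs
∣toSet∣ {n} []                  = ∣⊥∣≡0 n
∣toSet∣ {xs = x ∷ xs} (x# ∷ xs!) =
  trans (∣⁅x⁆∪p∣≡1+∣p∣ x (toSet xs) λ x∈xs → All.lookup x# (∈-toSet⁻ xs x∈xs) refl)
        (cong suc (∣toSet∣ xs!))

length≡∣_∣ : ∀ {xs} (C : Subset n) → Unique xs → (∀ i → i ∈ xs ⇔ i Subset.∈ C) → length xs ≡ ∣ C ∣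
length≡∣_∣ {xs = xs} C xs! eq = trans (sym (∣toSet∣ xs!))
  (cong ∣_∣ (⊆-antisym (to (eq _) ∘ ∈-toSet⁻ xs) (∈-toSet⁺ ∘ from (eq _))))

unique∧set⇒length : ∀ {xs ys : List (Fin n)} → Unique xs → Unique ys →
                    (∀ i → i ∈ xs ⇔ i ∈ ys) → length xs ≡ length ys
unique∧set⇒length {ys = ys} xs! ys! eq = trans
  (length≡∣ toSet ys ∣ xs! (λ i → mk⇔ (∈-toSet⁺ ∘ to (eq i)) (from (eq i) ∘ ∈-toSet⁻ ys)))
  (∣toSet∣ ys!)

-- Block length and position of an element

IsBlock : ℕ → A → List A → ℕ → Set
IsBlock j i S ℓ = length S ≡ j × AnyAt (i ≡_) ℓ S

Located : List (List A) → A → ℕ → ℕ → Set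
Located Ss i j ℓ = Any (λ S → IsBlock j i S ℓ) Ss

-- For partitioned orders this turns out to be `_≡₀_`, but it makes sense for any list of rows, in
-- particular for a single matrix.
infix 4 _≈_
_≈_ : List (List A) → List (List A) → Set
Ss ≈ Ts = ∀ i j ℓ → Located Ss i j ℓ ⇔ Located Ts i j ℓ

located⇒∈ : ∀ {Ss} {i : A} {j ℓ} → Located Ss i j ℓ → i ∈ concat Ss
located⇒∈ = ∈-concat⁺ ∘ Any.map λ {S} (_ , p) → anyAt⇒any _ S p

∈⇒located : ∀ Ss {i : A} → i ∈ concat Ss → ∃₂ (Located Ss i)
∈⇒located Ss i∈ = go (∈-concat⁻ Ss i∈)
  where
  go : ∀ {Ss} → Any (_ ∈_) Ss → ∃₂ (Located Ss _)
  go (here {x = S} p) = let ℓ , q = any⇒anyAt p in length S , ℓ , here (refl , q)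
  go (there p)        = let j , ℓ , q = go p in j , ℓ , there q

located-functional : ∀ {Ss} {i : A} {j j′ ℓ ℓ′} → Unique (concat Ss) →
                     Located Ss i j ℓ → Located Ss i j′ ℓ′ → j ≡ j′ × ℓ ≡ ℓ′
located-functional {Ss = S ∷ Ss} Ss! p q with unique-++⁻ S Ss!
located-functional Ss! (here (refl , p)) (here (refl , q)) | S! , _ , _ = refl , anyAt-functional S! _ _ p q
located-functional {Ss = S ∷ Ss} Ss! (here (_ , p)) (there q) | _ , _ , # =
  contradiction (anyAt⇒any _ S p , located⇒∈ q) #
located-functional {Ss = S ∷ Ss} Ss! (there p) (here (_ , q)) | _ , _ , # =
  contradiction (anyAt⇒any _ S q , located⇒∈ p) #
located-functional Ss! (there p) (there q) | _ , r , _ = located-functional r p q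

located⇒< : ∀ {Ss} {i : A} {j ℓ} → Located Ss i j ℓ → ℓ < j
located⇒< (here {x = S} (refl , p)) = anyAt-< _ S p
located⇒< (there p)                 = located⇒< p

unique⇒disjoint : ∀ {Ss : List (List A)} → Unique (concat Ss) → All Unique Ss × AllPairs Disjoint Ss
unique⇒disjoint {Ss = []}     []  = [] , []
unique⇒disjoint {Ss = S ∷ Ss} Ss! with unique-++⁻ S Ss!
... | S! , rest! , # = let Ss!′ , #′ = unique⇒disjoint rest! in
  S! ∷ Ss!′ , All.tabulate (λ T∈Ss (x∈S , x∈T) → # (x∈S , ∈-concat⁺′ x∈T T∈Ss)) ∷ #′

-- Equivalence of block-parallel modes in terms of locations

unique-entries : ∀ {Ss : List (List (Fin n))} → IsPartitionedOrder Ss → Unique (concat Ss)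
unique-entries po = Unique.concat⁺ distinct disjoint
  where open IsPartitionedOrder po

-- A form of ℓ % length S ≡ r that does not need NonZero (length S).
Hits : ℕ → A → List A → Set
Hits ℓ i S = ∃₂ λ r q → AnyAt (i ≡_) r S × ℓ ≡ r + q * length S

lookup-mod⇔ : ∀ ℓ {i : A} S (S≢[] : NonZero (length S)) →
              i ≡ lookup S (_mod_ ℓ (length S) {{S≢[]}}) ⇔ Hits ℓ i S
lookup-mod⇔ ℓ {i} S S≢[] = mk⇔
  (λ i≡ → ℓ % length S , ℓ / length S ,
    subst (λ r → AnyAt (i ≡_) r S) (toℕ-fromℕ< _) (anyAt-lookup⁺ S (ℓ mod length S) i≡) ,
    m≡m%n+[m/n]*n ℓ (length S))
  (λ (r , q , i∈r , ℓ≡) → anyAt-lookup⁻ S (ℓ mod length S)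
    (subst (λ r → AnyAt (i ≡_) r S)
      (sym (begin
        toℕ (ℓ mod length S)          ≡⟨ toℕ-fromℕ< _ ⟩
        ℓ % length S                  ≡⟨ cong (_% length S) ℓ≡ ⟩
        (r + q * length S) % length S ≡⟨ [m+kn]%n≡m%n r q (length S) ⟩
        r % length S                  ≡⟨ m<n⇒m%n≡m (anyAt-< r S i∈r) ⟩
        r                             ∎))
      i∈r))
  where
  open ≡-Reasoning
  instance _ = S≢[]

-- No location of `i` is fixed in advance here, which makes it visible that `W μ ℓ` depends on `μ`
-- only through `Located`.
∈-W⇔hits : ∀ (μ : BP n) ℓ i → i Subset.∈ W μ ℓ ⇔ ∃ λ j → ∃₂ λ r q → Located (proj₁ μ) i j r × ℓ ≡ r + q * j
∈-W⇔hits (Ss , po) ℓ i = mk⇔ (located ∘ hits (IsPartitionedOrder.nonempty po))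
  (λ (j , r , q , p , ℓ≡) → hit (IsPartitionedOrder.nonempty po)
    (Any.map (λ { (refl , p) → r , q , p , ℓ≡ }) p))
  where
  block : ∀ S → NonZero (length S) → Subset _
  block S S≢[] = ⁅ lookup S (_mod_ ℓ (length S) {{S≢[]}}) ⁆

  hits : ∀ {Ss} (nz : All (λ S → NonZero (length S)) Ss) →
         i Subset.∈ ⋃ (All.reduce (λ {S} → block S) nz) → Any (Hits ℓ i) Ss
  hits []       i∈ = contradiction i∈ ∉⊥
  hits (_∷_ {x = S} S≢[] nz) i∈ with x∈p∪q⁻ (block S S≢[]) _ i∈
  ... | inj₁ p = here (to (lookup-mod⇔ ℓ S S≢[]) (x∈⁅y⁆⇒x≡y _ p))
  ... | inj₂ p = there (hits nz p)

  hit : ∀ {Ss} (nz : All (λ S → NonZero (length S)) Ss) →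
        Any (Hits ℓ i) Ss → i Subset.∈ ⋃ (All.reduce (λ {S} → block S) nz)
  hit (_∷_ {x = S} S≢[] nz) (here h) = x∈p∪q⁺ (inj₁
    (subst (λ x → i Subset.∈ ⁅ x ⁆) (from (lookup-mod⇔ ℓ S S≢[]) h) (x∈⁅x⁆ i)))
  hit (_ ∷ nz) (there h) = x∈p∪q⁺ (inj₂ (hit nz h))

  located : ∀ {Ss} → Any (Hits ℓ i) Ss → ∃ λ j → ∃₂ λ r q → Located Ss i j r × ℓ ≡ r + q * j
  located (here {x = S} (r , q , p , ℓ≡)) = length S , r , q , here (refl , p) , ℓ≡
  located (there h) = let j , r , q , p , ℓ≡ = located h in j , r , q , there p , ℓ≡

-- Since `i` has only one location, the existential of `∈-W⇔hits` collapses to a single residue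
-- class.
∈-W⇔ : ∀ (μ : BP n) {i j r} .{{_ : NonZero j}} → Located (proj₁ μ) i j r →
       ∀ ℓ → i Subset.∈ W μ ℓ ⇔ ℓ % j ≡ r
∈-W⇔ μ@(Ss , po) {i} {j} {r} p ℓ = mk⇔
  (λ i∈ → let j′ , r′ , q , p′ , ℓ≡ = to (∈-W⇔hits μ ℓ i) i∈
              j≡ , r≡ = located-functional (unique-entries po) p p′ in
    begin
      ℓ % j             ≡⟨ cong (_% j) ℓ≡ ⟩
      (r′ + q * j′) % j ≡⟨ cong₂ (λ r j′ → (r + q * j′) % j) r≡ j≡ ⟨
      (r + q * j) % j   ≡⟨ [m+kn]%n≡m%n r q j ⟩
      r % j             ≡⟨ m<n⇒m%n≡m (located⇒< p) ⟩
      r                 ∎)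
  (λ ℓ%j≡r → from (∈-W⇔hits μ ℓ i)
    (j , r , ℓ / j , p , trans (m≡m%n+[m/n]*n ℓ j) (cong (_+ ℓ / j * j) ℓ%j≡r)))
  where open ≡-Reasoning

∣-lcm : ∀ {m ns} → m ∈ ns → m ∣ foldr lcm 1 ns
∣-lcm {ns = n ∷ ns} (here refl) = m∣lcm[m,n] n _
∣-lcm {ns = n ∷ ns} (there m∈)  = ∣-trans (∣-lcm m∈) (n∣lcm[m,n] n _)

lcm-∣ : ∀ {ns c} → All (_∣ c) ns → foldr lcm 1 ns ∣ c
lcm-∣ []           = 1∣ _
lcm-∣ (m∣c ∷ ns∣c) = lcm-least m∣c (lcm-∣ ns∣c)

-- The lcm of two numbers divides their product, so a zero lcm would make the product of nonzero
-- numbers zero.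
lcm-nonZero : ∀ {ns} → All NonZero ns → NonZero (foldr lcm 1 ns)
lcm-nonZero []                       = _
lcm-nonZero (_∷_ {m} {ns} m≢0 ns≢0) = ≢-nonZero λ lcm≡0 →
  ≢-nonZero⁻¹ (m * foldr lcm 1 ns)
    (0∣⇒≡0 (subst (_∣ m * foldr lcm 1 ns) lcm≡0
      (lcm-least {m} (m∣m*n {m} (foldr lcm 1 ns)) (n∣m*n m))))
  where instance
    _ = m≢0
    _ = lcm-nonZero ns≢0
    _ = m*n≢0 m (foldr lcm 1 ns)

located⇒∣period : ∀ (μ : BP n) {i j ℓ} → Located (proj₁ μ) i j ℓ → j ∣ period μ
located⇒∣period μ p = ∣-lcm (go p)
  where
  go : ∀ {Ss} → Located Ss _ _ _ → _ ∈ map length Ss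
  go (here (j≡ , _)) = here (sym j≡)
  go (there p)       = there (go p)

-- Meant for `φ μ ≡ φ ν`: the lengths give equal periods, the entries equal blocks within one
-- period.
map-upTo-injective : ∀ {f g : ℕ → A} {m k} → map f (upTo m) ≡ map g (upTo k) →
                     m ≡ k × (∀ {ℓ} → ℓ < m → f ℓ ≡ g ℓ)
map-upTo-injective {f = f} {g} {m} {k} eq with
  trans (sym (trans (length-map f (upTo m)) (length-upTo m)))
        (trans (cong length eq) (trans (length-map g (upTo k)) (length-upTo k)))
... | refl = refl , λ ℓ<m → agree (upTo m) eq (∈-upTo⁺ ℓ<m)
  where
  agree : ∀ ℓs → map f ℓs ≡ map g ℓs → ∀ {ℓ} → ℓ ∈ ℓs → f ℓ ≡ g ℓ
  agree (ℓ ∷ ℓs) eq (here refl) = proj₁ (∷-injective eq)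
  agree (ℓ ∷ ℓs) eq (there ℓ∈)  = agree ℓs (proj₂ (∷-injective eq)) ℓ∈

∈-concat-blocks : ∀ {Ss : List (List (Fin n))} → IsPartitionedOrder Ss → ∀ i → i ∈ concat Ss
∈-concat-blocks po i = ∈-concat⁺ (IsPartitionedOrder.covering po i)

≈-sym : ∀ {Ss Ts : List (List A)} → Ss ≈ Ts → Ts ≈ Ss
≈-sym Ss≈Ts i j ℓ = mk⇔ (from (Ss≈Ts i j ℓ)) (to (Ss≈Ts i j ℓ))

≈-trans : ∀ {Ss Ts Us : List (List A)} → Ss ≈ Ts → Ts ≈ Us → Ss ≈ Us
≈-trans Ss≈Ts Ts≈Us i j ℓ =
  mk⇔ (to (Ts≈Us i j ℓ) ∘ to (Ss≈Ts i j ℓ)) (from (Ss≈Ts i j ℓ) ∘ from (Ts≈Us i j ℓ))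

-- If the residue classes r mod j and r′ mod j′ agree, then r and r + j both lie in the second.
residue-∣ : ∀ {j j′ r r′} .{{_ : NonZero j}} .{{_ : NonZero j′}} → r < j →
            (∀ ℓ → ℓ % j ≡ r → ℓ % j′ ≡ r′) → j′ ∣ j
residue-∣ {j} {j′} {r} {r′} r<j r⊆r′ = ∣m+n∣m⇒∣n (divides ((r + j) / j′) eq) (n∣m*n (r / j′))
  where
  r% : r % j ≡ r
  r% = m<n⇒m%n≡m r<j
  eq : r / j′ * j′ + j ≡ (r + j) / j′ * j′
  eq = +-cancelˡ-≡ r′ _ _ (begin
    r′ + (r / j′ * j′ + j)                    ≡⟨ +-assoc r′ _ j ⟨
    r′ + r / j′ * j′ + j                      ≡⟨ cong (λ x → x + r / j′ * j′ + j) (r⊆r′ r r%) ⟨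
    r % j′ + r / j′ * j′ + j                  ≡⟨ cong (_+ j) (m≡m%n+[m/n]*n r j′) ⟨
    r + j                                     ≡⟨ m≡m%n+[m/n]*n (r + j) j′ ⟩
    (r + j) % j′ + (r + j) / j′ * j′          ≡⟨ cong (_+ (r + j) / j′ * j′)
                                                    (r⊆r′ (r + j) (trans ([m+n]%n≡m%n r j) r%)) ⟩
    r′ + (r + j) / j′ * j′                    ∎)
    where open ≡-Reasoning

period-nonZero : ∀ (μ : BP n) → NonZero (period μ)
period-nonZero (Ss , po) = lcm-nonZero (All.map⁺ (IsPartitionedOrder.nonempty po))

-- The o-blocks of `ν` cover everything, so `i` has some location there. Membership in the blocks
-- identifies the two residue classes, hence each modulus divides the other.
≡₀⇒located : ∀ (μ ν : BP n) → μ ≡₀ ν → ∀ {i j ℓ} → Located (proj₁ μ) i j ℓ → Located (proj₁ ν) i j ℓ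
≡₀⇒located μ ν μ≡ν {i} {j} {r} p = subst₂ (Located (proj₁ ν) i) (sym j≡j′) (sym r≡r′) p′
  where
  r′s = ∈⇒located (proj₁ ν) (∈-concat-blocks (proj₂ ν) i)
  j′  = proj₁ r′s
  r′  = proj₁ (proj₂ r′s)
  p′  = proj₂ (proj₂ r′s)
  instance
    _ = period-nonZero μ
    j≢0 : NonZero j
    j≢0 = >-nonZero (≤-<-trans z≤n (located⇒< p))
    j′≢0 : NonZero j′
    j′≢0 = >-nonZero (≤-<-trans z≤n (located⇒< p′))
  -- Blocks are known to agree only below the period. Reducing ℓ modulo the period changes neither
  -- residue, as `j` and `j′` both divide it.
  W≡ : ∀ ℓ → W μ (ℓ % period μ) ≡ W ν (ℓ % period μ)
  W≡ ℓ = proj₂ (map-upTo-injective μ≡ν) (m%n<n ℓ (period μ))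
  j∣ : j ∣ period μ
  j∣ = located⇒∣period μ p
  j′∣ : j′ ∣ period μ
  j′∣ = subst (j′ ∣_) (sym (proj₁ (map-upTo-injective μ≡ν))) (located⇒∣period ν p′)
  to′ : ∀ ℓ → ℓ % j ≡ r → ℓ % j′ ≡ r′
  to′ ℓ eq = trans (sym (m∣n⇒o%n%m≡o%m j′ _ ℓ j′∣)) (to (∈-W⇔ ν p′ _)
    (subst (i Subset.∈_) (W≡ ℓ) (from (∈-W⇔ μ p _) (trans (m∣n⇒o%n%m≡o%m j _ ℓ j∣) eq))))
  from′ : ∀ ℓ → ℓ % j′ ≡ r′ → ℓ % j ≡ r
  from′ ℓ eq = trans (sym (m∣n⇒o%n%m≡o%m j _ ℓ j∣)) (to (∈-W⇔ μ p _)
    (subst (i Subset.∈_) (sym (W≡ ℓ)) (from (∈-W⇔ ν p′ _) (trans (m∣n⇒o%n%m≡o%m j′ _ ℓ j′∣) eq))))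
  j≡j′ : j ≡ j′
  j≡j′ = ∣-antisym (residue-∣ (located⇒< p′) from′) (residue-∣ (located⇒< p) to′)
  r≡r′ : r ≡ r′
  -- The class of `r′` modulo `j′` contains `r′` itself, and `r′ < j` once the moduli agree.
  r≡r′ = trans (sym (from′ r′ (m<n⇒m%n≡m (located⇒< p′))))
               (m<n⇒m%n≡m (subst (r′ <_) (sym j≡j′) (located⇒< p′)))

≡₀⇒≈ : ∀ (μ ν : BP n) → μ ≡₀ ν → proj₁ μ ≈ proj₁ ν
≡₀⇒≈ μ ν μ≡ν i j ℓ = mk⇔ (≡₀⇒located μ ν μ≡ν) (≡₀⇒located ν μ (sym μ≡ν))

located⇒W⊆ : ∀ (μ ν : BP n) → proj₁ μ ≈ proj₁ ν → ∀ ℓ → W μ ℓ Subset.⊆ W ν ℓ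
located⇒W⊆ μ ν μ≈ν ℓ {i} i∈ = let j , r , q , p , ℓ≡ = to (∈-W⇔hits μ ℓ i) i∈ in
  from (∈-W⇔hits ν ℓ i) (j , r , q , to (μ≈ν i j r) p , ℓ≡)

-- Each o-block length is witnessed by the location of the first entry, so it is also a block length
-- in `ν` and divides the period of `ν`.
located⇒period∣ : ∀ (μ ν : BP n) → proj₁ μ ≈ proj₁ ν → period μ ∣ period ν
located⇒period∣ (Ss , po) ν μ≈ν = lcm-∣ (All.map⁺ (All.tabulate λ S∈Ss →
  located⇒∣period ν (to (μ≈ν _ _ 0) (first S∈Ss (All.lookup (IsPartitionedOrder.nonempty po) S∈Ss)))))
  where
  head : ∀ S → NonZero (length S) → A
  head (x ∷ _) _ = x
  first : ∀ {S Ss} → S ∈ Ss → (S≢[] : NonZero (length S)) → Located Ss (head S S≢[]) (length S) 0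
  first {x ∷ _} (here refl) _  = here (refl , refl)
  first (there S∈) S≢[] = there (first S∈ S≢[])

≈⇒≡₀ : ∀ (μ ν : BP n) → proj₁ μ ≈ proj₁ ν → μ ≡₀ ν
≈⇒≡₀ μ ν μ≈ν = trans
  (map-cong (λ ℓ → ⊆-antisym (located⇒W⊆ μ ν μ≈ν ℓ) (located⇒W⊆ ν μ (≈-sym μ≈ν) ℓ)) (upTo (period μ)))
  (cong (map (W ν) ∘ upTo)
    (∣-antisym (located⇒period∣ μ ν μ≈ν) (located⇒period∣ ν μ (≈-sym μ≈ν))))

-- Matrices by rows and by columns

prepend : List A → Matrix A → Matrix A
prepend = zipWith _∷_

module _ {P : A → Set} where

  prepend-head : ∀ c R → length c ≡ length R → Any (AnyAt P 0) (prepend c R) ⇔ Any P c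
  prepend-head c R eq = mk⇔ (⇒ c R) (⇐ c R eq)
    where
    ⇒ : ∀ c R → Any (AnyAt P 0) (prepend c R) → Any P c
    ⇒ (x ∷ c) (S ∷ R) (here p)  = here p
    ⇒ (x ∷ c) (S ∷ R) (there p) = there (⇒ c R p)
    ⇐ : ∀ c R → length c ≡ length R → Any P c → Any (AnyAt P 0) (prepend c R)
    ⇐ (x ∷ c) (S ∷ R) eq (here p)  = here p
    ⇐ (x ∷ c) (S ∷ R) eq (there p) = there (⇐ c R (suc-injective eq) p)

  prepend-tail : ∀ ℓ c R → length c ≡ length R →
                   Any (AnyAt P (suc ℓ)) (prepend c R) ⇔ Any (AnyAt P ℓ) R
  prepend-tail ℓ c R eq = mk⇔ (⇒ c R) (⇐ c R eq)
    where
    ⇒ : ∀ c R → Any (AnyAt P (suc ℓ)) (prepend c R) → Any (AnyAt P ℓ) R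
    ⇒ (x ∷ c) (S ∷ R) (here p)  = here p
    ⇒ (x ∷ c) (S ∷ R) (there p) = there (⇒ c R p)
    ⇐ : ∀ c R → length c ≡ length R → Any (AnyAt P ℓ) R → Any (AnyAt P (suc ℓ)) (prepend c R)
    ⇐ (x ∷ c) (S ∷ R) eq (here p)  = here p
    ⇐ (x ∷ c) (S ∷ R) eq (there p) = there (⇐ c R (suc-injective eq) p)

length-prepend : ∀ (c : List A) R → length c ≡ length R → length (prepend c R) ≡ length R
length-prepend []      []      eq = refl
length-prepend (x ∷ c) (S ∷ R) eq = cong suc (length-prepend c R (suc-injective eq))

prepend-rows : ∀ {j} (c : List A) {R} → All (λ S → length S ≡ j) R →
                 All (λ S → length S ≡ suc j) (prepend c R)
prepend-rows []      _          = []
prepend-rows (x ∷ c) []         = []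
prepend-rows (x ∷ c) (S≡j ∷ R≡j) = cong suc S≡j ∷ prepend-rows c R≡j

concat-prepend : ∀ (c : List A) R → length c ≡ length R → concat (prepend c R) ↭ c ++ concat R
concat-prepend []      []      eq = ↭-refl
concat-prepend (x ∷ c) (S ∷ R) eq = ↭-prep x
  (↭-trans (++⁺ˡ S (concat-prepend c R (suc-injective eq))) (shifts S c))

unzip-rows : ∀ {j} {X : Matrix A} → All (λ S → length S ≡ suc j) X →
             ∃₂ λ c R → length c ≡ length X × length R ≡ length X ×
                        All (λ S → length S ≡ j) R × prepend c R ≡ X
unzip-rows []                           = [] , [] , refl , refl , [] , refl
unzip-rows (_∷_ {x = x ∷ S} S≡ X≡) =
  let c , R , c≡ , R≡ , rows , eq = unzip-rows X≡ in
  x ∷ c , S ∷ R , cong suc c≡ , cong suc R≡ , suc-injective S≡ ∷ rows , cong ((x ∷ S) ∷_) eq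

module _ {m : ℕ} where

  length-fromColumns : {L : List (List A)} → All (λ c → length c ≡ m) L → length (fromColumns m L) ≡ m
  length-fromColumns []                = length-replicate m
  length-fromColumns (_∷_ {c} {L} c≡m L≡m) =
    trans (length-prepend c (fromColumns m L) (trans c≡m (sym ih))) ih
    where ih = length-fromColumns {L = L} L≡m

  length-column : ∀ {L : List (List A)} (c : List A) → length c ≡ m → All (λ c → length c ≡ m) L →
                  length c ≡ length (fromColumns m L)
  length-column {L = L} c c≡m L≡m = trans c≡m (sym (length-fromColumns {L = L} L≡m))

  fromColumns-rows : ∀ (L : List (List A)) → All (λ S → length S ≡ length L) (fromColumns m L)
  fromColumns-rows []      = All.replicate⁺ m refl
  fromColumns-rows (c ∷ L) = prepend-rows c (fromColumns-rows L)

  concat-fromColumns : ∀ {L : List (List A)} → All (λ c → length c ≡ m) L →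
                       concat (fromColumns m L) ↭ concat L
  concat-fromColumns {A = A} [] = concat-[]s m
    where
    concat-[]s : ∀ m → concat (replicate m []) ↭ ([] {A = A})
    concat-[]s zero    = ↭-refl
    concat-[]s (suc m) = concat-[]s m
  concat-fromColumns (_∷_ {c} {L} c≡m L≡m) = ↭-trans
    (concat-prepend c _ (length-column {L = L} c c≡m L≡m))
    (++⁺ˡ c (concat-fromColumns L≡m))

  anyAt-fromColumns : ∀ {L : List (List A)} {i} → All (λ c → length c ≡ m) L → ∀ ℓ →
                      Any (AnyAt (i ≡_) ℓ) (fromColumns m L) ⇔ AnyAt (i ∈_) ℓ L
  anyAt-fromColumns {A = A} {i = i} [] ℓ = mk⇔ (no-entry m) λ ()
    where
    no-entry : ∀ m → Any (AnyAt (i ≡_) ℓ) (replicate m ([] {A = A})) → ⊥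
    no-entry (suc m) (there p) = no-entry m p
  anyAt-fromColumns (_∷_ {c} {L} c≡m L≡m) zero = prepend-head c _ (length-column {L = L} c c≡m L≡m)
  anyAt-fromColumns (_∷_ {c} {L} c≡m L≡m) (suc ℓ) = mk⇔ (to ih ∘ to tail⇔) (from tail⇔ ∘ from ih)
    where
    ih = anyAt-fromColumns L≡m ℓ
    tail⇔ = prepend-tail ℓ c _ (length-column {L = L} c c≡m L≡m)

  -- All rows have the same length, so the location of an element is just the index of its column:
  -- how columns are matched into rows is invisible.
  located-fromColumns : ∀ {L : List (List A)} {i j ℓ} → All (λ c → length c ≡ m) L →
    Located (fromColumns m L) i j ℓ ⇔ (length L ≡ j × AnyAt (i ∈_) ℓ L)
  located-fromColumns {L = L} {i} {j} {ℓ} L≡m = mk⇔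
    (λ (p : Located (fromColumns m L) i j ℓ) → let S , S∈ , S≡j , _ = find p in
      trans (sym (All.lookup (fromColumns-rows L) S∈)) S≡j ,
      to (anyAt-fromColumns L≡m ℓ) (Any.map proj₂ p))
    (λ (L≡j , p) → go L≡j (fromColumns-rows L) (from (anyAt-fromColumns L≡m ℓ) p))
    where
    go : ∀ {X} → length L ≡ j → All (λ S → length S ≡ length L) X →
         Any (AnyAt (i ≡_) ℓ) X → Located X i j ℓ
    go L≡j (S≡ ∷ _) (here p)  = here (trans S≡ L≡j , p)
    go L≡j (_ ∷ X≡) (there p) = there (go L≡j X≡ p)

-- Lets o-blocks of a common length, given as rows, be treated as a possible result of `Block`.
toColumns : ∀ j {X : Matrix A} → All (λ S → length S ≡ j) X →
            ∃ λ L → All (λ c → length c ≡ length X) L × fromColumns (length X) L ≡ X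
toColumns zero    rows = [] , [] , empty-rows rows
  where
  empty-rows : ∀ {X : Matrix A} → All (λ S → length S ≡ 0) X → replicate (length X) [] ≡ X
  empty-rows []                      = refl
  empty-rows (_∷_ {x = []} _ X≡) = cong ([] ∷_) (empty-rows X≡)
toColumns (suc j) {X} rows =
  let c , R , c≡ , R≡ , rows′ , eq = unzip-rows rows
      L , L≡ , eq′ = toColumns j rows′
  in c ∷ L , c≡ ∷ subst (λ k → All (λ c → length c ≡ k) L) R≡ L≡ ,
     trans (cong (prepend c) (subst (λ k → fromColumns k L ≡ R) R≡ eq′)) eq

-- Nested enumeration, and the matrices produced by `Block`

unique-resp-↭ : ∀ {xs ys : List A} → xs ↭ ys → Unique xs → Unique ys
unique-resp-↭ xs↭ys = Permutation.Unique-resp-↭ (setoid _) (↭⇒↭ₛ xs↭ys)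

-- The shape of every nested loop: `S` separates the values run through, `R` the outputs. The
-- membership premises make the properties of the chosen values available.
concatMap⁺ : ∀ {R : A → A → Set} {S : B → B → Set} {f : B → List A} {xs} → AllPairs S xs →
             (∀ {x} → x ∈ xs → AllPairs R (f x)) →
             (∀ {x y a b} → x ∈ xs → y ∈ xs → S x y → a ∈ f x → b ∈ f y → R a b) →
             AllPairs R (concatMap f xs)
concatMap⁺ []             _     _      = []
concatMap⁺ {f = f} (x# ∷ xs!) inner across = AllPairs.++⁺ (inner (here refl))
  (concatMap⁺ xs! (inner ∘ there) (λ x∈ y∈ → across (there x∈) (there y∈)))
  (All.tabulate λ a∈ → All.tabulate λ b∈ →
    let y , y∈ , b∈′ = find (∈-concatMap⁻ f b∈) in
    across (here refl) (there y∈) (All.lookup x# y∈) a∈ b∈′)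

length-concat : ∀ {j} {X : Matrix A} → All (λ S → length S ≡ j) X → length (concat X) ≡ length X * j
length-concat []                      = refl
length-concat (_∷_ {x = S} S≡j X≡j) = trans (length-++ S) (cong₂ _+_ S≡j (length-concat X≡j))

x∈p─q⇒x∉q : ∀ (p : Subset n) {q x} → x Subset.∈ p ─ q → x Subset.∉ q
x∈p─q⇒x∉q (_ ∷ p) {true  ∷ q} (Vec.there x∈p─q) (Vec.there x∈q) = x∈p─q⇒x∉q p x∈p─q x∈q
x∈p─q⇒x∉q (_ ∷ p) {false ∷ q} (Vec.there x∈p─q) (Vec.there x∈q) = x∈p─q⇒x∉q p x∈p─q x∈q

_≉_ : Matrix A → Matrix A → Set
Ss ≉ Ts = ¬ (Ss ≈ Ts)

module _ (m : ℕ) where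

  -- The choices along one run of `BlockAux`, freed from depth bound and accumulator: each column
  -- comes from what the earlier ones leave, and the run ends only when nothing is left.
  data Columns {n : ℕ} (A : Subset n) : List (Subset n) → Set where
    []  : Empty A → Columns A []
    _∷_ : ∀ {B Bs} → B Subset.⊆ A × ∣ B ∣ ≡ m → Columns (A ─ B) Bs → Columns A (B ∷ Bs)

  columns-sizes : ∀ {A : Subset n} {Bs} → Columns A Bs → All (λ B → ∣ B ∣ ≡ m) Bs
  columns-sizes ([] _)              = []
  columns-sizes ((_ , ∣B∣≡m) ∷ cols) = ∣B∣≡m ∷ columns-sizes cols

  ∈-columns⇔ : ∀ {A : Subset n} {Bs i} → Columns A Bs → Any (i Subset.∈_) Bs ⇔ i Subset.∈ A
  ∈-columns⇔ {A = A} {i = i} ([] A≡∅) = mk⇔ (λ ()) λ i∈A → contradiction (i , i∈A) A≡∅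
  ∈-columns⇔ {A = A} {i = i} (_∷_ {B} (B⊆A , _) cols) = mk⇔
    (λ { (here i∈B)   → B⊆A i∈B
       ; (there i∈Bs) → p─q⊆p A B (to (∈-columns⇔ cols) i∈Bs) })
    λ i∈A → case-∈ i∈A (i ∈? B)
    where
    case-∈ : i Subset.∈ A → Dec (i Subset.∈ B) → Any (i Subset.∈_) (B ∷ _)
    case-∈ i∈A (yes i∈B) = here i∈B
    case-∈ i∈A (no i∉B)  = there (from (∈-columns⇔ cols) (x∈p∧x∉q⇒x∈p─q i∈A i∉B))

  columns-toSet : ∀ {A : Subset n} {L} → All (λ c → length c ≡ m) L → Unique (concat L) →
                  (∀ i → i ∈ concat L ⇔ i Subset.∈ A) → Columns A (map toSet L)
  columns-toSet []                            L! eq = [] λ (i , i∈A) → ∉[] (from (eq i) i∈A)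
  columns-toSet {A = A} (_∷_ {c} {L} c≡m L≡m) cL! eq with unique-++⁻ c cL!
  ... | c! , L! , # =
    ((λ i∈c → to (eq _) (∈-++⁺ˡ (∈-toSet⁻ c i∈c))) , trans (∣toSet∣ c!) c≡m) ∷
    columns-toSet L≡m L! λ i → mk⇔
      (λ i∈L → x∈p∧x∉q⇒x∈p─q (to (eq i) (∈-++⁺ʳ c i∈L)) λ i∈c → # (∈-toSet⁻ c i∈c , i∈L))
      (λ i∈A─c → case-∈ i∈A─c (∈-++⁻ c (from (eq i) (p─q⊆p A _ i∈A─c))))
    where
    case-∈ : ∀ {i} → i Subset.∈ A ─ toSet c → i ∈ c ⊎ i ∈ concat L → i ∈ concat L
    case-∈ i∈A─c (inj₁ i∈c) = contradiction (∈-toSet⁺ i∈c) (x∈p─q⇒x∉q A i∈A─c)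
    case-∈ i∈A─c (inj₂ i∈L) = i∈L

∷ʳ-++-injective : ∀ (xs : List A) {y z ys zs} → (xs ∷ʳ y) ++ ys ≡ (xs ∷ʳ z) ++ zs → y ≡ z
∷ʳ-++-injective xs {y} {z} {ys} {zs} eq = ∷-injectiveˡ (++-cancelˡ xs (y ∷ ys) (z ∷ zs)
  (trans (sym (++-assoc xs [ y ] ys)) (trans eq (++-assoc xs [ z ] zs))))

-- Membership by index does not see trailing empty sets, so the lengths are compared separately.
anyAt-ext : ∀ {Bs Cs : List (Subset n)} → length Bs ≡ length Cs →
            (∀ i ℓ → AnyAt (i Subset.∈_) ℓ Bs ⇔ AnyAt (i Subset.∈_) ℓ Cs) → Bs ≡ Cs
anyAt-ext {Bs = []}     {[]}     _   _  = refl
anyAt-ext {Bs = B ∷ Bs} {C ∷ Cs} len eq = cong₂ _∷_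
  (⊆-antisym (to (eq _ 0)) (from (eq _ 0)))
  (anyAt-ext (suc-injective len) (λ i ℓ → eq i (suc ℓ)))

anyAt-map : ∀ {P : B → Set} {Q : A → Set} {f : A → B} → (∀ x → P (f x) ⇔ Q x) →
            ∀ ℓ xs → AnyAt P ℓ (map f xs) ⇔ AnyAt Q ℓ xs
anyAt-map P⇔Q ℓ       []       = mk⇔ (λ ()) (λ ())
anyAt-map P⇔Q zero    (x ∷ xs) = P⇔Q x
anyAt-map P⇔Q (suc ℓ) (x ∷ xs) = anyAt-map P⇔Q ℓ xs

record IsBlockMatrix {n} (j m : ℕ) (A : Subset n) (X : Matrix (Fin n)) : Set where
  field
    rows    : All (λ S → length S ≡ j) X
    size    : length X ≡ m
    unique  : Unique (concat X)
    entries : ∀ i → i ∈ concat X ⇔ i Subset.∈ A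

module Blocks {n : ℕ} (orders : Orders n) where
  open Orders orders
  open Algorithm orders

  -- True for every bound `k`, since running out of it yields no output at all.
  ∈-blockAux⁻ : ∀ k A m Cs {Ds} → Ds ∈ blockAux′ k A m Cs →
                ∃ λ Bs → Ds ≡ Cs ++ Bs × Columns m A Bs
  ∈-blockAux⁻ (suc k) A m Cs Ds∈ with nonempty? A
  ∈-blockAux⁻ (suc k) A m Cs (here refl) | no A≡∅ = [] , sym (++-identityʳ Cs) , [] A≡∅
  ... | yes _ =
    let B , B∈ , Ds∈′ = find (∈-concatMap⁻ _ {xs = subsets A m} Ds∈)
        Bs , Ds≡ , cols = ∈-blockAux⁻ k (A ─ B) m (Cs ∷ʳ B) Ds∈′
    in B ∷ Bs , trans Ds≡ (++-assoc Cs [ B ] Bs) , to (proj₂ (subsets-correct A m) B) B∈ ∷ cols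

  ∈-blockAux⁺ : ∀ {A m} .{{_ : NonZero m}} Cs {Bs} → Columns m A Bs → Cs ++ Bs ∈ blockAux A m Cs
  ∈-blockAux⁺ {A} {m} Cs ([] A≡∅) with blockAux-unfold A m Cs
  ... | eq with nonempty? A
  ...   | yes A≢∅ = contradiction A≢∅ A≡∅
  ...   | no _    = here (++-identityʳ Cs)
  ∈-blockAux⁺ {A} {m} Cs (_∷_ {B} {Bs} B⊆A cols) =
    subst (_ ∈_) (sym (blockAux-unfold A m Cs)) (go (nonempty? A))
    where
    rest : (Cs ∷ʳ B) ++ Bs ∈ blockAux (A ─ B) m (Cs ∷ʳ B)
    rest = ∈-blockAux⁺ (Cs ∷ʳ B) cols
    go : (A? : Dec (Subset.Nonempty A)) → Cs ++ B ∷ Bs ∈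
      (if does A? then concatMap (λ B → blockAux (A ─ B) m (Cs ∷ʳ B)) (subsets A m) else [ Cs ])
    go (yes _) = ∈-concatMap⁺ _ (lose (from (proj₂ (subsets-correct A m) B) B⊆A)
                   (subst (_∈ blockAux (A ─ B) m (Cs ∷ʳ B)) (++-assoc Cs [ B ] Bs) rest))
    -- A column `B` inside the empty set would have size 0, while `m` is nonzero.
    go (no A≡∅) = contradiction
      (trans (sym (proj₂ B⊆A))
        (trans (cong ∣_∣ (Empty-unique λ (i , i∈B) → A≡∅ (i , proj₁ B⊆A i∈B))) (∣⊥∣≡0 n)))
      (≢-nonZero⁻¹ m)

  -- Every output extends the accumulator, so outputs from branches `B` and `B′` differ in the
  -- column right after `Cs`.
  blockAux-unique : ∀ k A m Cs → Unique (blockAux′ k A m Cs)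
  blockAux-unique zero    A m Cs = []
  blockAux-unique (suc k) A m Cs with nonempty? A
  ... | no _  = [] ∷ []
  ... | yes _ = concatMap⁺ (proj₁ (subsets-correct A m))
    (λ {B} _ → blockAux-unique k (A ─ B) m (Cs ∷ʳ B))
    λ {B} {B′} _ _ B≢B′ Ds∈ Ds′∈ Ds≡Ds′ →
      let _ , Ds≡ , _  = ∈-blockAux⁻ k (A ─ B) m (Cs ∷ʳ B) Ds∈
          _ , Ds′≡ , _ = ∈-blockAux⁻ k (A ─ B′) m (Cs ∷ʳ B′) Ds′∈
      in B≢B′ (∷ʳ-++-injective Cs (trans (sym Ds≡) (trans Ds≡Ds′ Ds′≡)))

  length-elements : ∀ C → length (elements C) ≡ ∣ C ∣
  length-elements C = let C! , ∈C = elements-correct C in length≡∣ C ∣ C! ∈C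

  module _ {m : ℕ} {A : Subset n} where

    element-lengths : ∀ {Bs} → Columns m A Bs → All (λ c → length c ≡ m) (map elements Bs)
    element-lengths = All.map⁺ ∘ All.map (λ {B} → trans (length-elements B)) ∘ columns-sizes m

    located-columns : ∀ {Bs i j ℓ} → Columns m A Bs →
      Located (fromColumns m (map elements Bs)) i j ℓ ⇔ (length Bs ≡ j × AnyAt (i Subset.∈_) ℓ Bs)
    located-columns {Bs} {i} {j} {ℓ} cols = mk⇔
      (λ p → let len , q = to loc p in trans (sym (length-map elements Bs)) len , to at q)
      (λ (len , q) → from loc (trans (length-map elements Bs) len , from at q))
      where
      loc = located-fromColumns {i = i} {j} {ℓ} (element-lengths cols)
      at  = anyAt-map {P = i ∈_} {Q = i Subset.∈_} {f = elements}
                      (λ C → proj₂ (elements-correct C) i) ℓ Bs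

  concat-elements⇔ : ∀ {i} Bs → i ∈ concat (map elements Bs) ⇔ Any (i Subset.∈_) Bs
  concat-elements⇔ {i} Bs = mk⇔
    (Any.map (λ {B} → to (proj₂ (elements-correct B) i)) ∘ Any.map⁻ ∘ ∈-concat⁻ (map elements Bs))
    (∈-concat⁺ ∘ Any.map⁺ ∘ Any.map (λ {B} → from (proj₂ (elements-correct B) i)))

  unique-elements : ∀ {m A Bs} → Columns m A Bs → Unique (concat (map elements Bs))
  unique-elements ([] _) = []
  unique-elements {A = A} (_∷_ {B} {Bs} _ cols) =
    Unique.++⁺ (proj₁ (elements-correct B)) (unique-elements cols)
    λ {i} (i∈B , i∈Bs) → x∈p─q⇒x∉q A (to (∈-columns⇔ _ cols) (to (concat-elements⇔ Bs) i∈Bs))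
                                   (to (proj₂ (elements-correct B) i) i∈B)

  columns⇒blockMatrix : ∀ {m A Bs} → Columns m A Bs →
    IsBlockMatrix (length Bs) m A (fromColumns m (map elements Bs))
  columns⇒blockMatrix {m} {A} {Bs} cols = record
    { rows    = subst (λ j → All (λ S → length S ≡ j) (fromColumns m (map elements Bs)))
                      (length-map elements Bs)
                      (fromColumns-rows (map elements Bs))
    ; size    = length-fromColumns (element-lengths cols)
    ; unique  = unique-resp-↭ (↭-sym transpose) (unique-elements cols)
    ; entries = λ i → mk⇔
        (to (∈-columns⇔ m cols) ∘ to (concat-elements⇔ Bs) ∘ ∈-resp-↭ transpose)
        (∈-resp-↭ (↭-sym transpose) ∘ from (concat-elements⇔ Bs) ∘ from (∈-columns⇔ m cols))
    }
    where transpose = concat-fromColumns (element-lengths cols)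

  -- Counts the entries of the matrix twice, as rows times columns and as the size of `A`, and
  -- cancels `m`. This supplies the number of columns, which `block` is not given.
  columns-length : ∀ {j m A Bs} .{{_ : NonZero m}} → ∣ A ∣ ≡ j * m → Columns m A Bs → length Bs ≡ j
  columns-length {j} {m} {A} {Bs} ∣A∣≡jm cols = *-cancelʳ-≡ _ j m (begin
    length Bs * m                                     ≡⟨ *-comm (length Bs) m ⟩
    m * length Bs                                     ≡⟨ cong (_* length Bs) size ⟨
    length X * length Bs                              ≡⟨ length-concat rows ⟨
    length (concat X)                                 ≡⟨ length≡∣ A ∣ unique entries ⟩
    ∣ A ∣                                             ≡⟨ ∣A∣≡jm ⟩
    j * m                                             ∎)
    where
    open ≡-Reasoning
    X = fromColumns m (map elements Bs)
    open IsBlockMatrix (columns⇒blockMatrix cols)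

  ∈-block⁻ : ∀ {j m A X} .{{_ : NonZero m}} → ∣ A ∣ ≡ j * m → X ∈ block A m →
             ∃ λ Bs → X ≡ fromColumns m (map elements Bs) × Columns m A Bs × length Bs ≡ j
  ∈-block⁻ {j} {m} {A} ∣A∣≡jm X∈ with ∈-map⁻ _ X∈
  ... | Bs , Bs∈ , X≡ with ∈-blockAux⁻ (suc ∣ A ∣) A m [] Bs∈
  ... | _ , refl , cols = Bs , X≡ , cols , columns-length {j} ∣A∣≡jm cols

  block⇒blockMatrix : ∀ {j m A X} .{{_ : NonZero m}} → ∣ A ∣ ≡ j * m → X ∈ block A m →
                      IsBlockMatrix j m A X
  block⇒blockMatrix {j} ∣A∣≡jm X∈ with ∈-block⁻ {j} ∣A∣≡jm X∈
  ... | _ , refl , cols , refl = columns⇒blockMatrix cols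

  columns-injective : ∀ {m A A′ Bs Cs} → Columns m A Bs → Columns m A′ Cs → length Bs ≡ length Cs →
    fromColumns m (map elements Bs) ≈ fromColumns m (map elements Cs) → Bs ≡ Cs
  columns-injective {Bs = Bs} {Cs} colsB colsC len eq = anyAt-ext len λ i ℓ → mk⇔
    (λ p → proj₂ (to (located-columns {i = i} {j = length Bs} {ℓ} colsC)
             (to (eq i _ ℓ) (from (located-columns colsB) (refl , p)))))
    (λ p → proj₂ (to (located-columns {i = i} {j = length Cs} {ℓ} colsB)
             (from (eq i _ ℓ) (from (located-columns colsC) (refl , p)))))

  -- The columns are recovered first; `A` and `A′` are both their union.
  block-injective : ∀ {j m A A′ X X′} .{{_ : NonZero m}} → ∣ A ∣ ≡ j * m → ∣ A′ ∣ ≡ j * m →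
                    X ∈ block A m → X′ ∈ block A′ m → X ≈ X′ → A ≡ A′
  block-injective {j} ∣A∣ ∣A′∣ X∈ X′∈ X≈X′ with ∈-block⁻ {j} ∣A∣ X∈ | ∈-block⁻ {j} ∣A′∣ X′∈
  ... | Bs , refl , cols , len | Cs , refl , cols′ , len′
    with columns-injective cols cols′ (trans len (sym len′)) X≈X′
  ... | refl = ⊆-antisym (to (∈-columns⇔ _ cols′) ∘ from (∈-columns⇔ _ cols))
                         (to (∈-columns⇔ _ cols) ∘ from (∈-columns⇔ _ cols′))

  block-distinct : ∀ {j A m} .{{_ : NonZero m}} → ∣ A ∣ ≡ j * m → AllPairs _≉_ (block A m)
  block-distinct {j} {A} {m} ∣A∣≡jm = AllPairs.map⁺ (go (blockAux-unique (suc ∣ A ∣) A m []) λ Bs∈ → Bs∈)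
    where
    X : List (Subset n) → Matrix (Fin n)
    X = fromColumns m ∘ map elements
    apart : ∀ {Bs Cs} → Bs ∈ blockAux A m [] → Cs ∈ blockAux A m [] → Bs ≢ Cs → X Bs ≉ X Cs
    apart {Bs} {Cs} Bs∈ Cs∈ Bs≢Cs eq 
      with ∈-blockAux⁻ (suc ∣ A ∣) A m [] Bs∈ | ∈-blockAux⁻ (suc ∣ A ∣) A m [] Cs∈
    ... | _ , refl , cols | _ , refl , cols′ = Bs≢Cs (columns-injective cols cols′ 
      (trans (columns-length {j} ∣A∣≡jm cols) (sym (columns-length {j} ∣A∣≡jm cols′))) eq)
    go : ∀ {Bss} → Unique Bss → (∀ {Bs} → Bs ∈ Bss → Bs ∈ blockAux A m []) →
         AllPairs (λ Bs Cs → X Bs ≉ X Cs) Bss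
    go []           _  = []
    go (Bs# ∷ Bss!) Bss⊆ =
      All.tabulate (λ Cs∈ → apart (Bss⊆ (here refl)) (Bss⊆ (there Cs∈)) (All.lookup Bs# Cs∈))
      ∷ go Bss! (Bss⊆ ∘ there)

-- Partitions and multiplicities

length-concat≡sum : ∀ (Ss : List (List A)) → length (concat Ss) ≡ sum (map length Ss)
length-concat≡sum []       = refl
length-concat≡sum (S ∷ Ss) = trans (length-++ S) (cong (length S +_) (length-concat≡sum Ss))

length-filter-map : ∀ {P : B → Set} (P? : Decidable P) (f : A → B) xs →
                    length (filter P? (map f xs)) ≡ length (filter (P? ∘ f) xs)
length-filter-map P? f []       = refl
length-filter-map P? f (x ∷ xs) with does (P? (f x))
... | true  = cong suc (length-filter-map P? f xs)
... | false = length-filter-map P? f xs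

concat-∷ʳ : ∀ (Ms : List (List A)) X → concat (Ms ∷ʳ X) ≡ concat Ms ++ X
concat-∷ʳ Ms X = trans (sym (concat-++ Ms [ X ])) (cong (concat Ms ++_) (++-identityʳ X))

multiplicity-↭ : ∀ {ps qs} → ps ↭ qs → ∀ j → multiplicity ps j ≡ multiplicity qs j
multiplicity-↭ ps↭qs j = ↭-length (filter-↭ (j ≟_) ps↭qs)

-- The bookkeeping of one stage: stage `j` contributes the parts equal to `j`. Only a permutation,
-- as these may stand anywhere in `ps`.
filter-<-suc : ∀ j ps → filter (_<? suc j) ps ↭ filter (_<? j) ps ++ replicate (multiplicity ps j) j
filter-<-suc j []       = ↭-refl
filter-<-suc j (p ∷ ps) = go (<-cmp p j)
  where
  open PermutationReasoning
  F = filter (_<? j) ps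
  ih = filter-<-suc j ps
  goal = filter (_<? suc j) (p ∷ ps) ↭ filter (_<? j) (p ∷ ps) ++ replicate (multiplicity (p ∷ ps) j) j
  go : Tri (p < j) (p ≡ j) (j < p) → goal
  go (tri< p<j p≢j _) = begin
    filter (_<? suc j) (p ∷ ps)            ≡⟨ filter-accept (_<? suc j) (m<n⇒m<1+n p<j) ⟩
    p ∷ filter (_<? suc j) ps              <⟨ ih ⟩
    p ∷ F ++ replicate (multiplicity ps j) j
      ≡⟨ cong₂ (λ xs ys → xs ++ replicate (length ys) j)
               (filter-accept (_<? j) p<j) (filter-reject (j ≟_) (p≢j ∘ sym)) ⟨
    filter (_<? j) (p ∷ ps) ++ replicate (multiplicity (p ∷ ps) j) j ∎
  go (tri≈ p≮j p≡j _) = begin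
    filter (_<? suc j) (p ∷ ps)            ≡⟨ filter-accept (_<? suc j) (s≤s (≤-reflexive p≡j)) ⟩
    p ∷ filter (_<? suc j) ps              <⟨ ih ⟩
    p ∷ F ++ replicate (multiplicity ps j) j ↭⟨ ↭-sym (shift p F _) ⟩
    F ++ p ∷ replicate (multiplicity ps j) j ≡⟨ cong (λ p → F ++ p ∷ _) p≡j ⟩
    F ++ replicate (suc (multiplicity ps j)) j
      ≡⟨ cong₂ (λ xs ys → xs ++ replicate (length ys) j)
               (filter-reject (_<? j) p≮j) (filter-accept (j ≟_) (sym p≡j)) ⟨
    filter (_<? j) (p ∷ ps) ++ replicate (multiplicity (p ∷ ps) j) j ∎
  go (tri> p≮j p≢j j<p) = begin
    filter (_<? suc j) (p ∷ ps)            ≡⟨ filter-reject (_<? suc j) (λ p<1+j → <⇒≱ j<p (≤-pred p<1+j)) ⟩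
    filter (_<? suc j) ps                  ↭⟨ ih ⟩
    F ++ replicate (multiplicity ps j) j
      ≡⟨ cong₂ (λ xs ys → xs ++ replicate (length ys) j)
               (filter-reject (_<? j) p≮j) (filter-reject (j ≟_) (p≢j ∘ sym)) ⟨
    filter (_<? j) (p ∷ ps) ++ replicate (multiplicity (p ∷ ps) j) j ∎

∈⇒≤maxPart : ∀ {p ps} → p ∈ ps → p ≤ maxPart ps
∈⇒≤maxPart {ps = q ∷ ps} (here refl) = m≤m⊔n q (maxPart ps)
∈⇒≤maxPart {ps = q ∷ ps} (there p∈)  = m≤n⇒m≤o⊔n q (∈⇒≤maxPart p∈)

∈⇒multiplicity>0 : ∀ {p ps} → p ∈ ps → 0 < multiplicity ps p
∈⇒multiplicity>0 {p} p∈ = ∈-length (∈-filter⁺ (p ≟_) p∈ refl)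

multiplicity>0⇒∈ : ∀ {p} ps → 0 < multiplicity ps p → p ∈ ps
multiplicity>0⇒∈ {p} ps m>0 with filter (p ≟_) ps in eq
... | q ∷ _ with ∈-filter⁻ (p ≟_) {xs = ps} (subst (q ∈_) (sym eq) (here refl))
...   | q∈ps , refl = q∈ps

-- Each head is the maximum of its list and, having positive multiplicity, occurs in the other list
-- too; so the heads agree and can be cancelled from the multiplicities.
decreasing-unique : ∀ {ps qs} → AllPairs _≥_ ps → AllPairs _≥_ qs → All (0 <_) ps → All (0 <_) qs →
                    (∀ j → 0 < j → multiplicity ps j ≡ multiplicity qs j) → ps ≡ qs
decreasing-unique {[]}    {[]}    _ _ _ _ _ = refl
decreasing-unique {[]}    {q ∷ qs} _ _ _ (q>0 ∷ _) eq =
  contradiction (subst (0 <_) (sym (eq q q>0)) (∈⇒multiplicity>0 {ps = q ∷ qs} (here refl))) n≮0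
decreasing-unique {p ∷ ps} {[]}   _ _ (p>0 ∷ _) _ eq =
  contradiction (subst (0 <_) (eq p p>0) (∈⇒multiplicity>0 {ps = p ∷ ps} (here refl))) n≮0
decreasing-unique {p ∷ ps} {q ∷ qs} (p≥ ∷ ps↘) (q≥ ∷ qs↘) (p>0 ∷ ps>0) (q>0 ∷ qs>0) eq = cong₂ _∷_ p≡q
  (decreasing-unique ps↘ qs↘ ps>0 qs>0 λ j j>0 → +-cancelˡ-≡ (multiplicity [ p ] j) _ _ (begin
    multiplicity [ p ] j + multiplicity ps j ≡⟨ split p ps j ⟨
    multiplicity (p ∷ ps) j                  ≡⟨ eq j j>0 ⟩
    multiplicity (q ∷ qs) j                  ≡⟨ split q qs j ⟩
    multiplicity [ q ] j + multiplicity qs j ≡⟨ cong (λ p → multiplicity [ p ] j + _) p≡q ⟨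
    multiplicity [ p ] j + multiplicity qs j ∎))
  where
  open ≡-Reasoning
  split : ∀ p ps j → multiplicity (p ∷ ps) j ≡ multiplicity [ p ] j + multiplicity ps j
  split p ps j = trans (cong length (filter-++ (j ≟_) [ p ] ps)) (length-++ (filter (j ≟_) [ p ]))
  ∈⇒≤ : ∀ {p q qs} → All (_≤ q) qs → p ∈ q ∷ qs → p ≤ q
  ∈⇒≤ _  (here refl) = ≤-refl
  ∈⇒≤ q≥ (there p∈)  = All.lookup q≥ p∈
  p≡q : p ≡ q
  p≡q = ≤-antisym
    (∈⇒≤ q≥ (multiplicity>0⇒∈ (q ∷ qs) (subst (0 <_) (eq p p>0) (∈⇒multiplicity>0 {ps = p ∷ ps} (here refl)))))
    (∈⇒≤ p≥ (multiplicity>0⇒∈ (p ∷ ps) (subst (0 <_) (sym (eq q q>0)) (∈⇒multiplicity>0 {ps = q ∷ qs} (here refl)))))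

-- The rows of one length

located-++⇔ : ∀ Ss {Ts} {i : A} {j ℓ} → Located (Ss ++ Ts) i j ℓ ⇔ (Located Ss i j ℓ ⊎ Located Ts i j ℓ)
located-++⇔ Ss = mk⇔ (Any.++⁻ Ss) λ { (inj₁ p) → Any.++⁺ˡ p ; (inj₂ p) → Any.++⁺ʳ Ss p }

located⇒∈lengths : ∀ {Ss} {i : A} {j ℓ} → Located Ss i j ℓ → j ∈ map length Ss
located⇒∈lengths (here (j≡ , _)) = here (sym j≡)
located⇒∈lengths (there p)       = there (located⇒∈lengths p)

located⇒length : ∀ {P : ℕ → Set} {Ss} {i : A} {j ℓ} → All (P ∘ length) Ss → Located Ss i j ℓ → P j
located⇒length PSs p = All.lookup (All.map⁺ PSs) (located⇒∈lengths p)

module _ (j : ℕ) where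

  ofLength : List (List A) → List (List A)
  ofLength = filter ((j ≟_) ∘ length)

  ofLength-rows : ∀ (Ss : List (List A)) → All (λ S → length S ≡ j) (ofLength Ss)
  ofLength-rows Ss = All.map sym (All.all-filter ((j ≟_) ∘ length) Ss)

  ofLength-unique : ∀ {Ss : List (List A)} → Unique (concat Ss) → Unique (concat (ofLength Ss))
  ofLength-unique {Ss = Ss} Ss! = let distinct , disjoint = unique⇒disjoint {Ss = Ss} Ss! in
    Unique.concat⁺ (All.filter⁺ ((j ≟_) ∘ length) distinct) (AllPairs.filter⁺ ((j ≟_) ∘ length) disjoint)

  located-ofLength⇔ : ∀ {Ss : List (List A)} {i j′ ℓ} →
                      Located (ofLength Ss) i j′ ℓ ⇔ (j′ ≡ j × Located Ss i j′ ℓ)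
  located-ofLength⇔ {Ss = Ss} = mk⇔
    (λ p → located⇒length {P = _≡ j} (ofLength-rows Ss) p , Any.filter⁻ _ p)
    (λ (j′≡j , p) → go j′≡j (find p))
    where
    go : ∀ {i j′ ℓ} → j′ ≡ j → (∃ λ S → S ∈ Ss × IsBlock j′ i S ℓ) → Located (ofLength Ss) i j′ ℓ
    go j′≡j (S , S∈ , p) = lose (∈-filter⁺ _ S∈ (trans (sym j′≡j) (sym (proj₁ p)))) p

∈-ofLength⇒located : ∀ j {Ss} {i : A} → i ∈ concat (ofLength j Ss) → ∃ (Located Ss i j)
∈-ofLength⇒located j {Ss} i∈ with ∈⇒located (ofLength j Ss) i∈
... | j′ , ℓ , p with to (located-ofLength⇔ j) p
... | refl , q = ℓ , q

-- The rows of length `j` have the same entries on both sides, and their number is the number of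
-- entries divided by `j`. Empty rows leave no trace in `_≈_`, whence `0 < j`.
count-≈ : ∀ {Ss Ts : List (List (Fin n))} → Unique (concat Ss) → Unique (concat Ts) → Ss ≈ Ts →
          ∀ j → 0 < j → multiplicity (map length Ss) j ≡ multiplicity (map length Ts) j
count-≈ {Ss = Ss} {Ts} Ss! Ts! Ss≈Ts j j>0 = begin
  multiplicity (map length Ss) j ≡⟨ length-filter-map (j ≟_) length Ss ⟩
  length (ofLength j Ss)         ≡⟨ *-cancelʳ-≡ _ _ j {{>-nonZero j>0}} entries ⟩
  length (ofLength j Ts)         ≡⟨ length-filter-map (j ≟_) length Ts ⟨
  multiplicity (map length Ts) j ∎
  where
  open ≡-Reasoning
  ⊆ : ∀ {Ss Ts : List (List (Fin _))} → (∀ {i ℓ} → Located Ss i j ℓ → Located Ts i j ℓ) →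
      ∀ {i} → i ∈ concat (ofLength j Ss) → i ∈ concat (ofLength j Ts)
  ⊆ Ss⊆Ts i∈ = let _ , p = ∈-ofLength⇒located j i∈ in
    located⇒∈ (from (located-ofLength⇔ j) (refl , Ss⊆Ts p))
  entries : length (ofLength j Ss) * j ≡ length (ofLength j Ts) * j
  entries = begin
    length (ofLength j Ss) * j    ≡⟨ length-concat (ofLength-rows j Ss) ⟨
    length (concat (ofLength j Ss)) ≡⟨ unique∧set⇒length
      (ofLength-unique j {Ss = Ss} Ss!) (ofLength-unique j {Ss = Ts} Ts!)
      (λ i → mk⇔ (⊆ {Ss} {Ts} (to (Ss≈Ts _ _ _))) (⊆ {Ts} {Ss} (from (Ss≈Ts _ _ _)))) ⟩
    length (concat (ofLength j Ts)) ≡⟨ length-concat (ofLength-rows j Ts) ⟩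
    length (ofLength j Ts) * j    ∎

full-cover : ∀ {xs : List (Fin n)} → Unique xs → length xs ≡ n → ∀ i → i ∈ xs
full-cover {xs = xs} xs! len i = ∈-toSet⁻ xs
  (subst (i Subset.∈_) (sym (∣p∣≡n⇒p≡⊤ (trans (∣toSet∣ xs!) len))) ∈⊤)

-- Turns pairwise inequivalence of list entries into uniqueness of the index, that is, uniqueness
-- counted with multiplicity.
lookup-injective : ∀ {E : A → A → Set} {xs} → AllPairs (λ x y → ¬ E x y) xs → (∀ {x y} → E x y → E y x) →
                   ∀ k k′ → E (lookup xs k) (lookup xs k′) → k ≡ k′
lookup-injective (x# ∷ xs#) E-sym zero    zero     e = refl
lookup-injective (x# ∷ xs#) E-sym zero    (suc k′) e = contradiction e (All.lookup x# (∈-lookup k′))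
lookup-injective (x# ∷ xs#) E-sym (suc k) zero     e = contradiction (E-sym e) (All.lookup x# (∈-lookup k))
lookup-injective (x# ∷ xs#) E-sym (suc k) (suc k′) e = cong suc (lookup-injective xs# E-sym k k′ e)

[]-≈ : ∀ {Ss : List (List A)} → 0 ≡ length Ss → [] ≈ Ss
[]-≈ {Ss = []} _ i j ℓ = mk⇔ id id

-- The stages of `Aux` for a fixed partition

module Runs {n : ℕ} (orders : Orders n) (ps : List ℕ) where
  open Orders orders
  open Algorithm orders
  open Blocks orders

  ∈-unused⁻ : ∀ Ms {i} → i Subset.∈ unused Ms → i ∉ concat (concat Ms)
  ∈-unused⁻ Ms i∈ i∈Ms = x∈∁p⇒x∉p i∈ (∈-toSet⁺ i∈Ms)

  ∈-unused⁺ : ∀ Ms {i} → i ∉ concat (concat Ms) → i Subset.∈ unused Ms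
  ∈-unused⁺ Ms i∉ = x∉p⇒x∈∁p (i∉ ∘ ∈-toSet⁻ (concat (concat Ms)))

  -- Skipping a stage of multiplicity 0 amounts to choosing the empty matrix on the empty set, so
  -- both branches of `Aux` share one description.
  ∈-aux⁻ : ∀ k j Ms {Ns} → Ns ∈ aux′ (suc k) ps j Ms → ∃₂ λ A X →
           A Subset.⊆ unused Ms × IsBlockMatrix j (multiplicity ps j) A X ×
           Ns ∈ aux′ k ps (suc j) (Ms ∷ʳ X)
  ∈-aux⁻ k j Ms Ns∈ with multiplicity ps j
  ... | zero      = Subset.⊥ , [] , ⊥⊆ , none , Ns∈
    where
    none : IsBlockMatrix j 0 Subset.⊥ []
    none = record { rows = [] ; size = refl ; unique = []
                  ; entries = λ i → mk⇔ (λ ()) (λ i∈⊥ → contradiction i∈⊥ ∉⊥) }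
  ... | m@(suc _) =
    let A , A∈ , Ns∈A = find (∈-concatMap⁻ _ {xs = subsets (unused Ms) (j * m)} Ns∈)
        X , X∈ , Ns∈X = find (∈-concatMap⁻ _ {xs = block A m} Ns∈A)
        A⊆ , ∣A∣      = to (proj₂ (subsets-correct _ _) A) A∈
    in A , X , A⊆ , block⇒blockMatrix {j} ∣A∣ X∈ , Ns∈X

  -- The invariant of a run that has finished the stages below `j`. Rows come by increasing length,
  -- an order that `ps` need not have, hence the permutation.
  record Valid (j : ℕ) (Ms : List (Matrix (Fin n))) : Set where
    field
      unique  : Unique (concat (concat Ms))
      lengths : map length (concat Ms) ↭ filter (_<? j) ps

  valid-∷ʳ : ∀ {j Ms A X} → Valid j Ms → A Subset.⊆ unused Ms →
             IsBlockMatrix j (multiplicity ps j) A X → Valid (suc j) (Ms ∷ʳ X)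
  valid-∷ʳ {j} {Ms} {A} {X} valid A⊆ isX = record
    { unique  = subst Unique (sym entries≡) (Unique.++⁺ (Valid.unique valid) unique
        λ (i∈Ms , i∈X) → ∈-unused⁻ Ms (A⊆ (to (entries _) i∈X)) i∈Ms)
    ; lengths = begin
        map length (concat (Ms ∷ʳ X))                      ≡⟨ cong (map length) (concat-∷ʳ Ms X) ⟩
        map length (concat Ms ++ X)                        ≡⟨ map-++ length (concat Ms) X ⟩
        map length (concat Ms) ++ map length X             ≡⟨ cong (map length (concat Ms) ++_) (X-lengths size rows) ⟩
        map length (concat Ms) ++ replicate (multiplicity ps j) j ↭⟨ ++⁺ʳ _ (Valid.lengths valid) ⟩
        filter (_<? j) ps ++ replicate (multiplicity ps j) j ↭⟨ filter-<-suc j ps ⟨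
        filter (_<? suc j) ps                              ∎
    }
    where
    open PermutationReasoning
    open IsBlockMatrix isX
    entries≡ : concat (concat (Ms ∷ʳ X)) ≡ concat (concat Ms) ++ concat X
    entries≡ = trans (cong concat (concat-∷ʳ Ms X)) (sym (concat-++ (concat Ms) X))
    X-lengths : ∀ {m X} → length X ≡ m → All (λ S → length S ≡ j) X → map length X ≡ replicate m j
    X-lengths refl []         = refl
    X-lengths refl (S≡j ∷ X≡j) = cong₂ _∷_ S≡j (X-lengths refl X≡j)

  aux-valid : ∀ k {j Ms Ns} → Valid j Ms → Ns ∈ aux′ k ps j Ms → Valid (k + j) Ns
  aux-valid zero            valid (here refl) = valid
  aux-valid (suc k) {j} {Ms} {Ns} valid Ns∈ =
    let A , X , A⊆ , isX , Ns∈′ = ∈-aux⁻ k j Ms Ns∈ in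
    subst (λ j → Valid j Ns) (+-suc k j) (aux-valid k (valid-∷ʳ valid A⊆ isX) Ns∈′)

  aux-extends : ∀ k {j Ms Ns} → Ns ∈ aux′ k ps j Ms →
                ∃ λ Ts → concat Ns ≡ concat Ms ++ Ts × All (λ S → j ≤ length S) Ts
  aux-extends zero            (here refl) = [] , sym (++-identityʳ _) , []
  aux-extends (suc k) {j} {Ms} Ns∈ =
    let A , X , _ , isX , Ns∈′ = ∈-aux⁻ k j Ms Ns∈
        Ts , Ns≡ , j<Ts = aux-extends k Ns∈′
    in X ++ Ts ,
       trans Ns≡ (trans (cong (_++ Ts) (concat-∷ʳ Ms X)) (++-assoc (concat Ms) X Ts)) ,
       All.++⁺ (All.map (≤-reflexive ∘ sym) (IsBlockMatrix.rows isX)) (All.map <⇒≤ j<Ts)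

  -- Rows before this stage are shorter than `j` and rows after it longer, so length `j` singles out
  -- the matrix `X` within the finished output.
  located-stage : ∀ k {j Ms X Ns i ℓ} → All (λ S → length S < j) (concat Ms) →
                  Ns ∈ aux′ k ps (suc j) (Ms ∷ʳ X) → Located (concat Ns) i j ℓ ⇔ Located X i j ℓ
  located-stage k {j} {Ms} {X} {Ns} {i} {ℓ} Ms<j Ns∈ with aux-extends k Ns∈
  ... | Ts , Ns≡ , j<Ts = mk⇔
    (λ p → skip-Ms (to (located-++⇔ (concat Ms)) (skip-Ts (to (located-++⇔ (concat Ms ++ X))
      (subst (λ Ss → Located Ss i j ℓ) Ns≡′ p)))))
    (λ p → subst (λ Ss → Located Ss i j ℓ) (sym Ns≡′) (Any.++⁺ˡ (Any.++⁺ʳ (concat Ms) p)))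
    where
    Ns≡′ = trans Ns≡ (cong (_++ Ts) (concat-∷ʳ Ms X))
    skip-Ts : Located (concat Ms ++ X) i j ℓ ⊎ Located Ts i j ℓ → Located (concat Ms ++ X) i j ℓ
    skip-Ts (inj₁ p) = p
    skip-Ts (inj₂ p) = contradiction (located⇒length {P = suc j ≤_} j<Ts p) (<-irrefl refl)
    skip-Ms : Located (concat Ms) i j ℓ ⊎ Located X i j ℓ → Located X i j ℓ
    skip-Ms (inj₁ p) = contradiction (located⇒length {P = _< j} Ms<j p) (<-irrefl refl)
    skip-Ms (inj₂ p) = p

  stage-≈ : ∀ k {j Ms X X′ Ns Ns′} → All (λ S → length S < j) (concat Ms) →
            All (λ S → length S ≡ j) X → All (λ S → length S ≡ j) X′ →
            Ns ∈ aux′ k ps (suc j) (Ms ∷ʳ X) → Ns′ ∈ aux′ k ps (suc j) (Ms ∷ʳ X′) →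
            concat Ns ≈ concat Ns′ → X ≈ X′
  stage-≈ k {j} Ms<j X≡j X′≡j Ns∈ Ns′∈ Ns≈Ns′ i j′ ℓ = mk⇔
    (λ p → case-≡ (located⇒length {P = _≡ j} X≡j p) p)
    (λ p → case-≡′ (located⇒length {P = _≡ j} X′≡j p) p)
    where
    case-≡ : j′ ≡ j → Located _ i j′ ℓ → Located _ i j′ ℓ
    case-≡ refl p = to (located-stage k Ms<j Ns′∈) (to (Ns≈Ns′ i j ℓ) (from (located-stage k Ms<j Ns∈) p))
    case-≡′ : j′ ≡ j → Located _ i j′ ℓ → Located _ i j′ ℓ
    case-≡′ refl p = to (located-stage k Ms<j Ns∈) (from (Ns≈Ns′ i j ℓ) (from (located-stage k Ms<j Ns′∈) p))

  ∷ʳ-rows : ∀ {j} Ms {X : Matrix (Fin n)} → All (λ S → length S < j) (concat Ms) →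
            All (λ S → length S ≡ j) X → All (λ S → length S < suc j) (concat (Ms ∷ʳ X))
  ∷ʳ-rows Ms {X} Ms<j X≡j = subst (All _) (sym (concat-∷ʳ Ms X))
    (All.++⁺ (All.map m<n⇒m<1+n Ms<j) (All.map (s≤s ∘ ≤-reflexive) X≡j))

  -- Equivalent outputs have equivalent matrices at stage `j`. Different sets `A` are then excluded
  -- by `block-injective`, different matrices on one set by `block-distinct`, and later choices by
  -- recursion.
  aux-distinct : ∀ k j Ms → All (λ S → length S < j) (concat Ms) →
                 AllPairs (_≉_ on concat) (aux′ k ps j Ms)
  aux-distinct zero    j Ms _    = [] ∷ []
  aux-distinct (suc k) j Ms Ms<j with multiplicity ps j
  ... | zero      = aux-distinct k (suc j) (Ms ∷ʳ []) (∷ʳ-rows Ms Ms<j [])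
  ... | m@(suc _) = concatMap⁺ (proj₁ (subsets-correct (unused Ms) (j * m)))
    (λ A∈ → concatMap⁺ (block-distinct {j} (size A∈))
      (λ {X} X∈ → aux-distinct k (suc j) (Ms ∷ʳ X) (∷ʳ-rows Ms Ms<j (rows A∈ X∈)))
      λ X∈ X′∈ X≉X′ Ns∈ Ns′∈ Ns≈Ns′ →
        X≉X′ (stage-≈ k Ms<j (rows A∈ X∈) (rows A∈ X′∈) Ns∈ Ns′∈ Ns≈Ns′))
    λ {A} {A′} A∈ A′∈ A≢A′ Ns∈ Ns′∈ Ns≈Ns′ →
      let X , X∈ , Ns∈X     = find (∈-concatMap⁻ _ {xs = block A m} Ns∈)
          X′ , X′∈ , Ns′∈X′ = find (∈-concatMap⁻ _ {xs = block A′ m} Ns′∈)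
      in A≢A′ (block-injective {j} (size A∈) (size A′∈) X∈ X′∈
                 (stage-≈ k Ms<j (rows A∈ X∈) (rows A′∈ X′∈) Ns∈X Ns′∈X′ Ns≈Ns′))
    where
    size : ∀ {A} → A ∈ subsets (unused Ms) (j * m) → ∣ A ∣ ≡ j * m
    size {A} A∈ = proj₂ (to (proj₂ (subsets-correct _ _) A) A∈)
    rows : ∀ {A X} → A ∈ subsets (unused Ms) (j * m) → X ∈ block A m → All (λ S → length S ≡ j) X
    rows A∈ X∈ = IsBlockMatrix.rows (block⇒blockMatrix {j} (size A∈) X∈)

  -- Y has the column sets of X, but may match their elements into other rows.
  block-complete : ∀ {j m A X} .{{_ : NonZero m}} → IsBlockMatrix j m A X → ∃ λ Y → Y ∈ block A m × Y ≈ X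
  block-complete {j} {A = A} {X} isX with IsBlockMatrix.size isX | toColumns j (IsBlockMatrix.rows isX)
  ... | refl | L , L≡m , L≡X = Y , ∈-map⁺ (fromColumns m ∘ map elements) (∈-blockAux⁺ [] cols) , λ i j′ ℓ →
    subst (λ X → Located Y i j′ ℓ ⇔ Located X i j′ ℓ) L≡X (mk⇔
      (λ p → let len , q = to (located-columns {j = j′} cols) p in
        from (located-fromColumns {j = j′} L≡m) (trans (sym (length-map toSet L)) len , to (at i ℓ) q))
      (λ p → let len , q = to (located-fromColumns {j = j′} L≡m) p in
        from (located-columns {j = j′} cols) (trans (length-map toSet L) len , from (at i ℓ) q)))
    where
    open IsBlockMatrix isX
    m = length X
    Y = fromColumns m (map elements (map toSet L))
    transpose : concat X ↭ concat L
    transpose = subst (λ X → concat X ↭ concat L) L≡X (concat-fromColumns L≡m)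
    cols : Columns m A (map toSet L)
    cols = columns-toSet m L≡m (unique-resp-↭ transpose unique) λ i → mk⇔
      (to (entries i) ∘ ∈-resp-↭ (↭-sym transpose)) (∈-resp-↭ transpose ∘ from (entries i))
    at : ∀ i ℓ → AnyAt (i Subset.∈_) ℓ (map toSet L) ⇔ AnyAt (i ∈_) ℓ L
    at i ℓ = anyAt-map (λ c → mk⇔ (∈-toSet⁻ c) ∈-toSet⁺) ℓ L

  module _ {Ss : List (List (Fin n))} (Ss! : Unique (concat Ss))
           (count : ∀ j → multiplicity ps j ≡ length (ofLength j Ss)) where

    -- The rows of `Ss` themselves may never be output; what a suitable run can reproduce is the
    -- location of each element lying in a row shorter than `j`.
    AgreesBelow : ℕ → List (Matrix (Fin n)) → Set
    AgreesBelow j Ms = ∀ i j′ ℓ → Located (concat Ms) i j′ ℓ ⇔ (j′ < j × Located Ss i j′ ℓ)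

    agrees-∷ʳ : ∀ {j Ms X} → AgreesBelow j Ms → X ≈ ofLength j Ss → AgreesBelow (suc j) (Ms ∷ʳ X)
    agrees-∷ʳ {j} {Ms} {X} agrees X≈ i j′ ℓ = subst (λ Ts → Located Ts i j′ ℓ ⇔ (j′ < suc j × Located Ss i j′ ℓ))
      (sym (concat-∷ʳ Ms X)) (mk⇔ (⇒ ∘ to (located-++⇔ (concat Ms))) (from (located-++⇔ (concat Ms)) ∘ ⇐))
      where
      ⇒ : Located (concat Ms) i j′ ℓ ⊎ Located X i j′ ℓ → j′ < suc j × Located Ss i j′ ℓ
      ⇒ (inj₁ p) = let j′<j , q = to (agrees i j′ ℓ) p in m<n⇒m<1+n j′<j , q
      ⇒ (inj₂ p) = let j′≡j , q = to (located-ofLength⇔ j) (to (X≈ i j′ ℓ) p) in s≤s (≤-reflexive j′≡j) , q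
      ⇐ : j′ < suc j × Located Ss i j′ ℓ → Located (concat Ms) i j′ ℓ ⊎ Located X i j′ ℓ
      ⇐ (j′<1+j , p) with m≤n⇒m<n∨m≡n (≤-pred j′<1+j)
      ... | inj₁ j′<j = inj₁ (from (agrees i j′ ℓ) (j′<j , p))
      ... | inj₂ j′≡j = inj₂ (from (X≈ i j′ ℓ) (from (located-ofLength⇔ j) (j′≡j , p)))

    -- An element already placed has a location in `Ss` of length below `j`, so it cannot also lie
    -- in a row of length `j`.
    ofLength⊆unused : ∀ {j Ms} → AgreesBelow j Ms → toSet (concat (ofLength j Ss)) Subset.⊆ unused Ms
    ofLength⊆unused {j} {Ms} agrees {i} i∈ = ∈-unused⁺ Ms λ i∈Ms →
      let ℓ , p = ∈-ofLength⇒located j (∈-toSet⁻ (concat (ofLength j Ss)) i∈)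
          j′ , ℓ′ , p′ = ∈⇒located (concat Ms) i∈Ms
          j′<j , q = to (agrees i j′ ℓ′) p′
      in <⇒≢ j′<j (proj₁ (located-functional Ss! q p))

    -- The run is steered by `Ss`: at stage `j` the subset is the set of entries of its rows of
    -- length `j`, and `block-complete` gives a matrix with the right columns.
    aux-complete : ∀ k j Ms → AgreesBelow j Ms → ∃ λ Ns → Ns ∈ aux′ k ps j Ms × AgreesBelow (k + j) Ns
    aux-complete zero    j Ms agrees = Ms , here refl , agrees
    aux-complete (suc k) j Ms agrees with multiplicity ps j | count j
    ... | zero | eq =
      let Ns , Ns∈ , agrees′ = aux-complete k (suc j) (Ms ∷ʳ []) (agrees-∷ʳ {Ms = Ms} agrees ([]-≈ eq)) in
      Ns , Ns∈ , subst (λ j → AgreesBelow j Ns) (+-suc k j) agrees′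
    ... | m@(suc _) | eq =
      let Y , Y∈ , Y≈ = block-complete isX
          Ns , Ns∈ , agrees′ = aux-complete k (suc j) (Ms ∷ʳ Y) (agrees-∷ʳ {Ms = Ms} agrees Y≈)
      in Ns ,
         ∈-concatMap⁺ _ (lose C∈ (∈-concatMap⁺ _ (lose Y∈ Ns∈))) ,
         subst (λ j → AgreesBelow j Ns) (+-suc k j) agrees′
      where
      X = ofLength j Ss
      C = toSet (concat X)
      isX : IsBlockMatrix j m C X
      isX = record
        { rows = ofLength-rows j Ss ; size = sym eq ; unique = ofLength-unique j {Ss = Ss} Ss!
        ; entries = λ i → mk⇔ ∈-toSet⁺ (∈-toSet⁻ (concat X)) }
      C∈ : C ∈ subsets (unused Ms) (j * m)
      C∈ = from (proj₂ (subsets-correct _ _) C) (ofLength⊆unused {Ms = Ms} agrees , (begin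
        ∣ C ∣           ≡⟨ ∣toSet∣ (ofLength-unique j {Ss = Ss} Ss!) ⟩
        length (concat X) ≡⟨ length-concat (ofLength-rows j Ss) ⟩
        length X * j    ≡⟨ cong (_* j) eq ⟨
        m * j           ≡⟨ *-comm m j ⟩
        j * m           ∎))
        where open ≡-Reasoning

-- All partitions together

module _ {n : ℕ} (orders : Orders n) where
  open Orders orders
  open Algorithm orders

  module _ {ps : List ℕ} (ps-partition : IsPartition n ps) where
    open IsPartition ps-partition
    open Runs orders ps

    -- Starting at 1, the run performs `maxPart ps` stages and stops at `maxPart ps + 1`, a
    -- threshold above all parts.
    filter-all-parts : filter (_<? maxPart ps + 1) ps ≡ ps
    filter-all-parts = filter-all (_<? maxPart ps + 1)
      (All.tabulate λ {p} p∈ → subst (p <_) (+-comm 1 (maxPart ps)) (s≤s (∈⇒≤maxPart p∈)))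

    valid-[] : Valid 1 []
    valid-[] = record { unique = [] ; lengths = ↭-reflexive (sym (filter-none (_<? 1)
      (All.map (λ 0<p p<1 → <⇒≱ 0<p (≤-pred p<1)) positive))) }

    output-valid : ∀ {Ms} → Ms ∈ aux ps 1 [] → Unique (concat (concat Ms)) × map length (concat Ms) ↭ ps
    output-valid Ms∈ = let valid = aux-valid (maxPart ps) valid-[] Ms∈ in
      Valid.unique valid , ↭-trans (Valid.lengths valid) (↭-reflexive filter-all-parts)

    output-partitionedOrder : ∀ {Ms} → Ms ∈ aux ps 1 [] → IsPartitionedOrder (represented Ms)
    output-partitionedOrder {Ms} Ms∈ = let Ms! , lengths = output-valid Ms∈
                                           distinct , disjoint = unique⇒disjoint {Ss = concat Ms} Ms! in record
      { nonempty = All.map >-nonZero (All.map⁻ (All-resp-↭ (↭-sym lengths) positive))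
      ; distinct = distinct
      ; disjoint = disjoint
      ; covering = λ i → ∈-concat⁻ (concat Ms) (full-cover Ms!
          (trans (length-concat≡sum (concat Ms)) (trans (sum-↭ lengths) total)) i)
      }

  ≈⇒≡-partition : ∀ {ps qs Ms Ns} → IsPartition n ps → IsPartition n qs →
                  Ms ∈ aux ps 1 [] → Ns ∈ aux qs 1 [] → concat Ms ≈ concat Ns → ps ≡ qs
  ≈⇒≡-partition {ps} {qs} {Ms} {Ns} ps-part qs-part Ms∈ Ns∈ Ms≈Ns =
    let Ms! , Ms↭ps = output-valid ps-part Ms∈
        Ns! , Ns↭qs = output-valid qs-part Ns∈
    in decreasing-unique
      (Linked⇒AllPairs ≥-trans (decreasing ps-part)) (Linked⇒AllPairs ≥-trans (decreasing qs-part))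
      (positive ps-part) (positive qs-part)
      λ j j>0 → trans (sym (multiplicity-↭ Ms↭ps j))
        (trans (count-≈ {Ss = concat Ms} {concat Ns} Ms! Ns! Ms≈Ns j j>0) (multiplicity-↭ Ns↭qs j))
    where
    open IsPartition
    ≥-trans : ∀ {a b c} → a ≥ b → b ≥ c → a ≥ c
    ≥-trans a≥b b≥c = ≤-trans b≥c a≥b

  isPartition⇔ : ∀ ps → ps ∈ partitions ⇔ IsPartition n ps
  isPartition⇔ = proj₂ partitions-correct

  outputs-distinct : AllPairs (_≉_ on represented) enumBPeq0
  outputs-distinct = concatMap⁺ (proj₁ partitions-correct)
    (λ {ps} _ → Runs.aux-distinct orders ps (maxPart ps) 1 [] [])
    λ ps∈ qs∈ ps≢qs Ms∈ Ns∈ Ms≈Ns →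
      ps≢qs (≈⇒≡-partition (to (isPartition⇔ _) ps∈) (to (isPartition⇔ _) qs∈) Ms∈ Ns∈ Ms≈Ns)

  outputs-valid : ∀ {Ms} → Ms ∈ enumBPeq0 → IsPartitionedOrder (represented Ms)
  outputs-valid Ms∈ =
    let ps , ps∈ , Ms∈ps = find (∈-concatMap⁻ (λ ps → aux ps 1 []) {xs = partitions} Ms∈) in
    output-partitionedOrder (to (isPartition⇔ ps) ps∈) Ms∈ps

  outputs-complete : ∀ {Ss} → IsPartitionedOrder Ss → ∃ λ Ms → Ms ∈ enumBPeq0 × represented Ms ≈ Ss
  outputs-complete {Ss} po =
    let Ms , Ms∈ , agrees = aux-complete Ss! count (maxPart ps) 1 [] empty in
    Ms , ∈-concatMap⁺ _ (lose (from (isPartition⇔ ps) ps-partition) Ms∈) ,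
    λ i j ℓ → mk⇔ (proj₂ ∘ to (agrees i j ℓ)) λ p → from (agrees i j ℓ)
      (subst (j <_) (+-comm 1 (maxPart ps))
         (s≤s (∈⇒≤maxPart (∈-resp-↭ (↭-sym (sort-↭ _)) (located⇒∈lengths p)))) , p)
    where
    -- The flipped order makes `sort` decreasing, as `IsPartition` demands.
    open Data.List.Sort (decTotalOrder ≤-decTotalOrder)
    open IsPartitionedOrder po
    Ss! = unique-entries po
    ps = sort (map length Ss)
    open Runs orders ps
    ps-partition : IsPartition n ps
    ps-partition = isPartition (sort-↗ _)
      (All-resp-↭ (↭-sym (sort-↭ _)) (All.map⁺ (All.map (λ {S} S≢[] → >-nonZero⁻¹ (length S) {{S≢[]}}) nonempty)))
      (begin
        sum ps               ≡⟨ sum-↭ (sort-↭ (map length Ss)) ⟩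
        sum (map length Ss)  ≡⟨ length-concat≡sum Ss ⟨
        length (concat Ss)   ≡⟨ length≡∣ Subset.⊤ ∣ Ss! (λ i → mk⇔ (λ _ → ∈⊤) (λ _ → ∈-concat⁺ (covering i))) ⟩
        ∣ Subset.⊤ {n} ∣     ≡⟨ ∣⊤∣≡n n ⟩
        n                    ∎)
      where open ≡-Reasoning
    count : ∀ j → multiplicity ps j ≡ length (ofLength j Ss)
    count j = trans (multiplicity-↭ (sort-↭ (map length Ss)) j) (length-filter-map (j ≟_) length Ss)
    empty : AgreesBelow Ss! count 1 []
    -- A location forces a row of positive length, so nothing has to be placed before stage 1.
    empty i j ℓ = mk⇔ (λ ()) λ (j<1 , p) → contradiction (<-≤-trans (located⇒< p) (≤-pred j<1)) n≮0

theorem3 : ∀ (n : ℕ) → n ≥ 1 → (orders : Orders n) →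
    let outputs = Algorithm.enumBPeq0 orders in
    Σ[ valid ∈ (∀ (k : Fin (length outputs)) → IsPartitionedOrder (represented (lookup outputs k))) ]
    (∀ (μ : BP n) → ∃! _≡_ (λ (k : Fin (length outputs)) → (represented (lookup outputs k) , valid k) ≡₀ μ))
theorem3 n _ orders = valid , λ μ →
  let Ms , Ms∈ , Ms≈μ = outputs-complete orders (proj₂ μ)
      k = Any.index Ms∈
      out≈μ = subst (λ Ms → represented Ms ≈ proj₁ μ) (Any.lookup-index Ms∈) Ms≈μ
  in k , ≈⇒≡₀ (output k) μ out≈μ ,
     λ {k′} out′≡μ → lookup-injective {E = λ Ms Ns → represented Ms ≈ represented Ns}
       (outputs-distinct orders) ≈-sym k k′
       (≈-trans out≈μ (≈-sym (≡₀⇒≈ (output k′) μ out′≡μ)))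
  where
  valid : ∀ k → IsPartitionedOrder (represented (lookup (Algorithm.enumBPeq0 orders) k))
  valid k = outputs-valid orders (∈-lookup k)
  output : Fin (length (Algorithm.enumBPeq0 orders)) → BP n
  output k = represented (lookup (Algorithm.enumBPeq0 orders) k) , valid k
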